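{- Let $\mathsf{R}$ be a principal ideal domain with field of fractions $\mathsf{k}$. The square of PROP morphisms with top edge $[\kappa_1,\kappa_2]:\mathsf{Mat}\,\mathsf{R}+(\mathsf{Mat}\,\mathsf{R})^{op}\to\mathsf{Span}(\mathsf{Mat}\,\mathsf{R})$, left edge $[\iota_1,\iota_2]:\mathsf{Mat}\,\mathsf{R}+(\mathsf{Mat}\,\mathsf{R})^{op}\to\mathsf{Cospan}(\mathsf{Mat}\,\mathsf{R})$, right edge $\Phi:\mathsf{Span}(\mathsf{Mat}\,\mathsf{R})\to\mathbb{SV}_{\mathsf{k}}$ and bottom edge $\Psi:\mathsf{Cospan}(\mathsf{Mat}\,\mathsf{R})\to\mathbb{SV}_{\mathsf{k}}$ is a pushout in the category $\mathbf{PROP}$ of PROPs.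
   Context: A PROP is a strict symmetric monoidal category whose objects are the natural numbers and whose monoidal product $\oplus$ on objects is addition. Morphisms of PROPs are identity-on-objects strict symmetric monoidal functors; $\mathbf{PROP}$ is the resulting category and $+$ denotes its coproduct. Composition is in diagrammatic order $f;g$. $\mathsf{Mat}\,\mathsf{R}$ is the PROP whose arrows $n\to m$ are $m\times n$ matrices over $\mathsf{R}$, with $A;B$ the matrix product $BA$, $A\oplus B$ block-diagonal, and permutation matrices as symmetries. Since $\mathsf{R}$ is a PID it has pullbacks and pushouts. $\mathsf{Span}(\mathsf{Mat}\,\mathsf{R})$ (resp. $\mathsf{Cospan}(\mathsf{Mat}\,\mathsf{R})$) is the PROP whose arrows $n\to m$ are isomorphism classes of spans $n\leftarrow z\to m$ (resp. cospans $n\to z\leftarrow m$) in $\mathsf{Mat}\,\mathsf{R}$, composed by pullback (resp. pushout), with $\oplus$ inherited from $\mathsf{Mat}\,\mathsf{R}$. $\mathbb{SV}_{\mathsf{k}}$ is the PROP whose arrows $n\to m$ are $\mathsf{k}$-linear subspaces of $\mathsf{k}^n\times\mathsf{k}^m$, with relational composition, direct sum as $\oplus$, and symmetry $n+m\to m+n$ given by $\{(\binom{\mathbf{x}}{\mathbf{y}},\binom{\mathbf{y}}{\mathbf{x}}):\mathbf{x}\in\mathsf{k}^n,\mathbf{y}\in\mathsf{k}^m\}$. The morphisms are: for $A:n\to m$ in $\mathsf{Mat}\,\mathsf{R}$, $\kappa_1(A)=(n\xleftarrow{\mathrm{id}}n\xrightarrow{A}m)$ and $\iota_1(A)=(n\xrightarrow{A}m\xleftarrow{\mathrm{id}}m)$;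 for $A:n\to m$ in $(\mathsf{Mat}\,\mathsf{R})^{op}$ (i.e. a matrix $A:m\to n$ in $\mathsf{Mat}\,\mathsf{R}$), $\kappa_2(A)=(n\xleftarrow{A}m\xrightarrow{\mathrm{id}}m)$ and $\iota_2(A)=(n\xrightarrow{\mathrm{id}}n\xleftarrow{A}m)$; $\Phi(n\xleftarrow{A}z\xrightarrow{B}m)=\{(\mathbf{x},\mathbf{y}):\mathbf{x}\in\mathsf{k}^n,\mathbf{y}\in\mathsf{k}^m,\exists\mathbf{z}\in\mathsf{k}^z.\ A\mathbf{z}=\mathbf{x}\wedge B\mathbf{z}=\mathbf{y}\}$; $\Psi(n\xrightarrow{A}z\xleftarrow{B}m)=\{(\mathbf{x},\mathbf{y}):\mathbf{x}\in\mathsf{k}^n,\mathbf{y}\in\mathsf{k}^m,A\mathbf{x}=B\mathbf{y}\}$. -}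

module Defs where

open import Level using (Level; _⊔_; Lift; lift; lower) renaming (suc to lsuc)
open import Algebra.Bundles using (CommutativeRing)
open import Algebra.Morphism.Structures using (IsRingMonomorphism)
import Algebra.Properties.Ring as RingProperties
import Algebra.Properties.Semiring.Sum as Sum
open import Data.Empty using (⊥-elim)
open import Data.Fin.Base as Fin using (Fin; zero; suc; splitAt; join; _↑ˡ_; _↑ʳ_)
open import Data.Fin.Properties using (splitAt-↑ˡ; splitAt-↑ʳ; join-splitAt; cast-is-id)
open import Data.Nat.Base using (ℕ; zero; suc; _+_)
open import Data.Nat.Properties using (+-assoc; +-identityʳ; suc-injective)
open import Data.Product.Base using (Σ-syntax; ∃; ∃₂; _×_; _,_; proj₁; proj₂)
open import Data.Sum.Base using (_⊎_; inj₁; inj₂)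
open import Data.Vec.Functional using (Vector; _∷_; _++_; head; tail; take; drop; replicate; transpose)
import Data.Vec.Functional.Relation.Binary.Equality.Setoid as VecEquality
open import Function.Bundles using (_⇔_; mk⇔; Equivalence)
import Function.Properties.Equivalence as ⇔
open import Relation.Binary.Core using (Rel; REL)
open import Relation.Binary.Bundles using (Setoid)
open import Relation.Binary.Structures using (IsEquivalence)
open import Relation.Binary.PropositionalEquality.Core as ≡ using (_≡_)
import Relation.Binary.Reasoning.Setoid as SetoidReasoning
open import Relation.Nullary using (¬_; Dec; yes; no; contradiction)
open import Relation.Unary using (Pred; _≐_)

private
  variable
    c ℓ c′ ℓ′ h e h₁ e₁ h₂ e₂ h₃ e₃ : Level

-- Hom-sets are setoids.  Associativity and right unitality of + on objects
-- hold only propositionally in ℕ, so the strictness laws for ⊕ mention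
-- `cast p`, which is the identity morphism read along p : m ≡ n.
-- The unit coherence of σ follows from ⊕-assoc, σ-hexagon and σ-involutive.

record PROP (h e : Level) : Set (lsuc (h ⊔ e)) where
  infix  4 _≈_
  infixr 7 _⨾_
  infixr 8 _⊕_
  field
    Hom : ℕ → ℕ → Set h
    _≈_ : ∀ {m n} → Rel (Hom m n) e
    id  : ∀ {n} → Hom n n
    _⨾_ : ∀ {m n p} → Hom m n → Hom n p → Hom m p
    _⊕_ : ∀ {m n p q} → Hom m n → Hom p q → Hom (m + p) (n + q)
    σ   : ∀ m n → Hom (m + n) (n + m)

  cast : ∀ {m n} → m ≡ n → Hom m n
  cast {m} p = ≡.subst (Hom m) p id

  field
    isEquivalence : ∀ {m n} → IsEquivalence (_≈_ {m} {n})

    ⨾-cong : ∀ {m n p} {f f′ : Hom m n} {g g′ : Hom n p} →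
             f ≈ f′ → g ≈ g′ → f ⨾ g ≈ f′ ⨾ g′
    idˡ    : ∀ {m n} {f : Hom m n} → id ⨾ f ≈ f
    idʳ    : ∀ {m n} {f : Hom m n} → f ⨾ id ≈ f
    assoc  : ∀ {m n p q} {f : Hom m n} {g : Hom n p} {k : Hom p q} →
             (f ⨾ g) ⨾ k ≈ f ⨾ (g ⨾ k)

    ⊕-cong : ∀ {m n p q} {f f′ : Hom m n} {g g′ : Hom p q} →
             f ≈ f′ → g ≈ g′ → f ⊕ g ≈ f′ ⊕ g′
    ⊕-id   : ∀ {m n} → id {m} ⊕ id {n} ≈ id
    ⊕-⨾    : ∀ {m n p m′ n′ p′} {f : Hom m n} {g : Hom n p}
             {f′ : Hom m′ n′} {g′ : Hom n′ p′} →
             (f ⨾ g) ⊕ (f′ ⨾ g′) ≈ (f ⊕ f′) ⨾ (g ⊕ g′)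

    ⊕-identityˡ : ∀ {m n} {f : Hom m n} → id {0} ⊕ f ≈ f
    ⊕-identityʳ : ∀ {m n} {f : Hom m n} →
                  (f ⊕ id {0}) ⨾ cast (+-identityʳ n) ≈ cast (+-identityʳ m) ⨾ f
    ⊕-assoc     : ∀ {m n p m′ n′ p′} {f : Hom m m′} {g : Hom n n′} {k : Hom p p′} →
                  ((f ⊕ g) ⊕ k) ⨾ cast (+-assoc m′ n′ p′)
                  ≈ cast (+-assoc m n p) ⨾ (f ⊕ (g ⊕ k))

    σ-natural    : ∀ {m n m′ n′} {f : Hom m m′} {g : Hom n n′} →
                   (f ⊕ g) ⨾ σ m′ n′ ≈ σ m n ⨾ (g ⊕ f)
    σ-involutive : ∀ {m n} → σ m n ⨾ σ n m ≈ id
    σ-hexagon    : ∀ {m n p} →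
                   cast (+-assoc m n p) ⨾ σ m (n + p) ⨾ cast (+-assoc n p m)
                   ≈ (σ m n ⊕ id {p}) ⨾ cast (+-assoc n m p) ⨾ (id {n} ⊕ σ m p)

  setoid : ℕ → ℕ → Setoid h e
  setoid m n = record { isEquivalence = isEquivalence {m} {n} }

  module _ {m n : ℕ} where
    open IsEquivalence (isEquivalence {m} {n}) public
      using (refl; sym; trans)

module PROPProperties (A : PROP h e) where
  open PROP A

  ⨾-congˡ : ∀ {m n p} {f : Hom m n} {g g′ : Hom n p} → g ≈ g′ → f ⨾ g ≈ f ⨾ g′
  ⨾-congˡ = ⨾-cong refl

  ⨾-congʳ : ∀ {m n p} {f f′ : Hom m n} {g : Hom n p} → f ≈ f′ → f ⨾ g ≈ f′ ⨾ g
  ⨾-congʳ eq = ⨾-cong eq refl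

  infix 4 _InverseOf_
  _InverseOf_ : ∀ {m n} → Hom m n → Hom n m → Set e
  f InverseOf g = f ⨾ g ≈ id × g ⨾ f ≈ id

  private
    cancel : ∀ {m n p} {f : Hom m n} {f′ : Hom n m} {g : Hom n p} {g′ : Hom p n} →
             f ⨾ f′ ≈ id → g ⨾ g′ ≈ id → (f ⨾ g) ⨾ (g′ ⨾ f′) ≈ id
    cancel p q = trans assoc (trans (⨾-congˡ (trans (sym assoc)
                   (trans (⨾-congʳ q) idˡ))) p)

  ⨾-inverse : ∀ {m n p} {f : Hom m n} {f′ : Hom n m} {g : Hom n p} {g′ : Hom p n} →
              f InverseOf f′ → g InverseOf g′ → (f ⨾ g) InverseOf (g′ ⨾ f′)
  ⨾-inverse (p , p′) (q , q′) = cancel p q , cancel q′ p′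

  ⊕-inverse : ∀ {m n p q} {f : Hom m n} {f′ : Hom n m} {g : Hom p q} {g′ : Hom q p} →
              f InverseOf f′ → g InverseOf g′ → (f ⊕ g) InverseOf (f′ ⊕ g′)
  ⊕-inverse (p , p′) (q , q′) =
    trans (sym ⊕-⨾) (trans (⊕-cong p q) ⊕-id) ,
    trans (sym ⊕-⨾) (trans (⊕-cong p′ q′) ⊕-id)

  id-inverse : ∀ {n} → id {n} InverseOf id
  id-inverse = idˡ , idˡ

  σ-inverse : ∀ {m n} → σ m n InverseOf σ n m
  σ-inverse = σ-involutive , σ-involutive

  cast-inverse : ∀ {m n} (p : m ≡ n) → cast p InverseOf cast (≡.sym p)
  cast-inverse ≡.refl = idˡ , idˡ

  -- inverses are unique, and reverse commuting squares
  inverse-unique : ∀ {m n} {f g : Hom m n} {f′ g′ : Hom n m} →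
                   f InverseOf f′ → g InverseOf g′ → f ≈ g → f′ ≈ g′
  inverse-unique (_ , p) (q , _) eq =
    trans (sym idʳ) (trans (⨾-congˡ (sym q)) (trans (sym assoc)
      (trans (⨾-congʳ (trans (⨾-congˡ (sym eq)) p)) idˡ)))

  inverse-square : ∀ {m n p q} {f : Hom m n} {g : Hom p q}
                   {u : Hom m p} {u′ : Hom p m} {v : Hom n q} {v′ : Hom q n} →
                   u InverseOf u′ → v InverseOf v′ → f ⨾ v ≈ u ⨾ g → u′ ⨾ f ≈ g ⨾ v′
  inverse-square {f = f} {g} {u} {u′} {v} {v′} (_ , p) (q , _) eq = begin
    u′ ⨾ f               ≈⟨ idʳ ⟨
    (u′ ⨾ f) ⨾ id        ≈⟨ ⨾-congˡ q ⟨
    (u′ ⨾ f) ⨾ (v ⨾ v′)  ≈⟨ assoc ⟨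
    ((u′ ⨾ f) ⨾ v) ⨾ v′  ≈⟨ ⨾-congʳ (trans assoc (⨾-congˡ eq)) ⟩
    (u′ ⨾ (u ⨾ g)) ⨾ v′  ≈⟨ ⨾-congʳ (trans (sym assoc) (trans (⨾-congʳ p) idˡ)) ⟩
    g ⨾ v′               ∎
    where open SetoidReasoning (setoid _ _)

-- Identity on objects: a morphism of PROPs only acts on arrows.

record _⇒_ (A : PROP h₁ e₁) (B : PROP h₂ e₂) : Set (h₁ ⊔ e₁ ⊔ h₂ ⊔ e₂) where
  private
    module A = PROP A
    module B = PROP B
  field
    map    : ∀ {m n} → A.Hom m n → B.Hom m n
    cong   : ∀ {m n} {f g : A.Hom m n} → f A.≈ g → map f B.≈ map g
    map-id : ∀ {n} → map (A.id {n}) B.≈ B.id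
    map-⨾  : ∀ {m n p} {f : A.Hom m n} {g : A.Hom n p} →
             map (f A.⨾ g) B.≈ map f B.⨾ map g
    map-⊕  : ∀ {m n p q} {f : A.Hom m n} {g : A.Hom p q} →
             map (f A.⊕ g) B.≈ map f B.⊕ map g
    map-σ  : ∀ {m n} → map (A.σ m n) B.≈ B.σ m n

infix 1 _⇒_

open _⇒_ using (map)

infixr 9 _∘_
_∘_ : {A : PROP h₁ e₁} {B : PROP h₂ e₂} {C : PROP h₃ e₃} → B ⇒ C → A ⇒ B → A ⇒ C
_∘_ {C = C} G F = record
  { map    = λ f → G.map (F.map f)
  ; cong   = λ eq → G.cong (F.cong eq)
  ; map-id = C.trans (G.cong F.map-id) G.map-id
  ; map-⨾  = C.trans (G.cong F.map-⨾) G.map-⨾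
  ; map-⊕  = C.trans (G.cong F.map-⊕) G.map-⊕
  ; map-σ  = C.trans (G.cong F.map-σ) G.map-σ
  }
  where
  module C = PROP C
  module F = _⇒_ F
  module G = _⇒_ G

infix 4 _≗_
_≗_ : {A : PROP h₁ e₁} {B : PROP h₂ e₂} → Rel (A ⇒ B) (h₁ ⊔ e₂)
_≗_ {A = A} {B = B} F G = ∀ {m n} (f : PROP.Hom A m n) → PROP._≈_ B (map F f) (map G f)

-- The levels a, b are those of the PROPs against which universality is
-- tested; the corners themselves may live at different levels.

record IsPushout (a b : Level)
  {S : PROP h e} {A : PROP h₁ e₁} {B : PROP h₂ e₂} {P : PROP h₃ e₃}
  (top : S ⇒ A) (left : S ⇒ B) (right : A ⇒ P) (bottom : B ⇒ P)
  : Set (lsuc (a ⊔ b) ⊔ h ⊔ e ⊔ h₁ ⊔ e₁ ⊔ h₂ ⊔ e₂ ⊔ h₃ ⊔ e₃) where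
  field
    commutes  : right ∘ top ≗ bottom ∘ left
    universal : (X : PROP a b) (F : A ⇒ X) (G : B ⇒ X) → F ∘ top ≗ G ∘ left →
                Σ[ H ∈ (P ⇒ X) ]
                  (H ∘ right ≗ F × H ∘ bottom ≗ G ×
                   ((K : P ⇒ X) → K ∘ right ≗ F → K ∘ bottom ≗ G → K ≗ H))

infix 10 _ᵒᵖ
_ᵒᵖ : PROP h e → PROP h e
A ᵒᵖ = record
  { Hom = λ m n → Hom n m
  ; _≈_ = _≈_
  ; id = id
  ; _⨾_ = λ f g → g ⨾ f
  ; _⊕_ = _⊕_
  ; σ = λ m n → σ n m
  ; isEquivalence = isEquivalence
  ; ⨾-cong = λ p q → ⨾-cong q p
  ; idˡ = idʳ
  ; idʳ = idˡ
  ; assoc = sym assoc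
  ; ⊕-cong = ⊕-cong
  ; ⊕-id = ⊕-id
  ; ⊕-⨾ = ⊕-⨾
  ; ⊕-identityˡ = ⊕-identityˡ
  ; ⊕-identityʳ = λ {m} {n} →
      inverse-square (inverseᵒᵖ (+-identityʳ n)) (inverseᵒᵖ (+-identityʳ m)) ⊕-identityʳ
  ; ⊕-assoc = λ {m} {n} {p} {m′} {n′} {p′} →
      inverse-square (inverseᵒᵖ (+-assoc m′ n′ p′)) (inverseᵒᵖ (+-assoc m n p)) ⊕-assoc
  ; σ-natural = sym σ-natural
  ; σ-involutive = σ-involutive
  ; σ-hexagon = λ {m} {n} {p} → inverse-unique
      (⨾-inverse (inverseᵒᵖ (+-assoc m n p))
        (⨾-inverse σ-inverse (inverseᵒᵖ (+-assoc n p m))))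
      (⨾-inverse (⊕-inverse σ-inverse id-inverse)
        (⨾-inverse (inverseᵒᵖ (+-assoc n m p)) (⊕-inverse id-inverse σ-inverse)))
      σ-hexagon
  }
  where
  open PROP A
  open PROPProperties A
  inverseᵒᵖ : ∀ {m n} (p : m ≡ n) → cast p InverseOf ≡.subst (λ k → Hom k m) p id
  inverseᵒᵖ ≡.refl = idˡ , idˡ

double-op : (A : PROP h e) → A ⇒ (A ᵒᵖ) ᵒᵖ
double-op A = record
  { map = λ f → f ; cong = λ eq → eq ; map-id = refl ; map-⨾ = refl ; map-⊕ = refl ; map-σ = refl }
  where open PROP A

-- The coproduct of A and B in the category of PROPs: terms built from the arrows
-- of A and B by the PROP operations, modulo the least congruence that satisfies
-- the PROP laws and makes both injections morphisms of PROPs.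

module Coproduct where

  module _ (A : PROP h₁ e₁) (B : PROP h₂ e₂) where
    private
      module A = PROP A
      module B = PROP B

    infixr 7 _⨾ₜ_
    infixr 8 _⊕ₜ_
    data Term : ℕ → ℕ → Set (h₁ ⊔ h₂) where
      inl  : ∀ {m n} → A.Hom m n → Term m n
      inr  : ∀ {m n} → B.Hom m n → Term m n
      idₜ  : ∀ {n} → Term n n
      _⨾ₜ_ : ∀ {m n p} → Term m n → Term n p → Term m p
      _⊕ₜ_ : ∀ {m n p q} → Term m n → Term p q → Term (m + p) (n + q)
      σₜ   : ∀ m n → Term (m + n) (n + m)

    castₜ : ∀ {m n} → m ≡ n → Term m n
    castₜ {m} p = ≡.subst (Term m) p idₜ

    infix 4 _∼_
    data _∼_ : ∀ {m n} → Rel (Term m n) (h₁ ⊔ h₂ ⊔ e₁ ⊔ e₂) where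
      ∼-refl  : ∀ {m n} {f : Term m n} → f ∼ f
      ∼-sym   : ∀ {m n} {f g : Term m n} → f ∼ g → g ∼ f
      ∼-trans : ∀ {m n} {f g k : Term m n} → f ∼ g → g ∼ k → f ∼ k

      ⨾-cong : ∀ {m n p} {f f′ : Term m n} {g g′ : Term n p} →
               f ∼ f′ → g ∼ g′ → f ⨾ₜ g ∼ f′ ⨾ₜ g′
      idˡ    : ∀ {m n} {f : Term m n} → idₜ ⨾ₜ f ∼ f
      idʳ    : ∀ {m n} {f : Term m n} → f ⨾ₜ idₜ ∼ f
      assoc  : ∀ {m n p q} {f : Term m n} {g : Term n p} {k : Term p q} →
               (f ⨾ₜ g) ⨾ₜ k ∼ f ⨾ₜ (g ⨾ₜ k)

      ⊕-cong : ∀ {m n p q} {f f′ : Term m n} {g g′ : Term p q} →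
               f ∼ f′ → g ∼ g′ → f ⊕ₜ g ∼ f′ ⊕ₜ g′
      ⊕-id   : ∀ {m n} → idₜ {m} ⊕ₜ idₜ {n} ∼ idₜ
      ⊕-⨾    : ∀ {m n p m′ n′ p′} {f : Term m n} {g : Term n p}
               {f′ : Term m′ n′} {g′ : Term n′ p′} →
               (f ⨾ₜ g) ⊕ₜ (f′ ⨾ₜ g′) ∼ (f ⊕ₜ f′) ⨾ₜ (g ⊕ₜ g′)

      ⊕-identityˡ : ∀ {m n} {f : Term m n} → idₜ {0} ⊕ₜ f ∼ f
      ⊕-identityʳ : ∀ {m n} {f : Term m n} →
                    (f ⊕ₜ idₜ {0}) ⨾ₜ castₜ (+-identityʳ n) ∼ castₜ (+-identityʳ m) ⨾ₜ f
      ⊕-assoc     : ∀ {m n p m′ n′ p′} {f : Term m m′} {g : Term n n′} {k : Term p p′} →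
                    ((f ⊕ₜ g) ⊕ₜ k) ⨾ₜ castₜ (+-assoc m′ n′ p′)
                    ∼ castₜ (+-assoc m n p) ⨾ₜ (f ⊕ₜ (g ⊕ₜ k))

      σ-natural    : ∀ {m n m′ n′} {f : Term m m′} {g : Term n n′} →
                     (f ⊕ₜ g) ⨾ₜ σₜ m′ n′ ∼ σₜ m n ⨾ₜ (g ⊕ₜ f)
      σ-involutive : ∀ {m n} → σₜ m n ⨾ₜ σₜ n m ∼ idₜ
      σ-hexagon    : ∀ {m n p} →
                     castₜ (+-assoc m n p) ⨾ₜ σₜ m (n + p) ⨾ₜ castₜ (+-assoc n p m)
                     ∼ (σₜ m n ⊕ₜ idₜ {p}) ⨾ₜ castₜ (+-assoc n m p) ⨾ₜ (idₜ {n} ⊕ₜ σₜ m p)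

      inl-cong : ∀ {m n} {f g : A.Hom m n} → f A.≈ g → inl f ∼ inl g
      inl-id   : ∀ {n} → inl (A.id {n}) ∼ idₜ
      inl-⨾    : ∀ {m n p} {f : A.Hom m n} {g : A.Hom n p} → inl (f A.⨾ g) ∼ inl f ⨾ₜ inl g
      inl-⊕    : ∀ {m n p q} {f : A.Hom m n} {g : A.Hom p q} →
                 inl (f A.⊕ g) ∼ inl f ⊕ₜ inl g
      inl-σ    : ∀ {m n} → inl (A.σ m n) ∼ σₜ m n

      inr-cong : ∀ {m n} {f g : B.Hom m n} → f B.≈ g → inr f ∼ inr g
      inr-id   : ∀ {n} → inr (B.id {n}) ∼ idₜ
      inr-⨾    : ∀ {m n p} {f : B.Hom m n} {g : B.Hom n p} → inr (f B.⨾ g) ∼ inr f ⨾ₜ inr g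
      inr-⊕    : ∀ {m n p q} {f : B.Hom m n} {g : B.Hom p q} →
                 inr (f B.⊕ g) ∼ inr f ⊕ₜ inr g
      inr-σ    : ∀ {m n} → inr (B.σ m n) ∼ σₜ m n

  infixr 6 _+ᴾ_
  _+ᴾ_ : PROP h₁ e₁ → PROP h₂ e₂ → PROP (h₁ ⊔ h₂) (h₁ ⊔ h₂ ⊔ e₁ ⊔ e₂)
  A +ᴾ B = record
    { Hom = Term A B
    ; _≈_ = _∼_ A B
    ; id = idₜ
    ; _⨾_ = _⨾ₜ_
    ; _⊕_ = _⊕ₜ_
    ; σ = σₜ
    ; isEquivalence = record { refl = ∼-refl ; sym = ∼-sym ; trans = ∼-trans }
    ; ⨾-cong = ⨾-cong
    ; idˡ = idˡ
    ; idʳ = idʳ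
    ; assoc = assoc
    ; ⊕-cong = ⊕-cong
    ; ⊕-id = ⊕-id
    ; ⊕-⨾ = ⊕-⨾
    ; ⊕-identityˡ = ⊕-identityˡ
    ; ⊕-identityʳ = ⊕-identityʳ
    ; ⊕-assoc = ⊕-assoc
    ; σ-natural = σ-natural
    ; σ-involutive = σ-involutive
    ; σ-hexagon = σ-hexagon
    }

  module _ {A : PROP h₁ e₁} {B : PROP h₂ e₂} where

    injˡ : A ⇒ A +ᴾ B
    injˡ = record { map = inl ; cong = inl-cong ; map-id = inl-id ; map-⨾ = inl-⨾
                ; map-⊕ = inl-⊕ ; map-σ = inl-σ }

    injʳ : B ⇒ A +ᴾ B
    injʳ = record { map = inr ; cong = inr-cong ; map-id = inr-id ; map-⨾ = inr-⨾
                ; map-⊕ = inr-⊕ ; map-σ = inr-σ }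

    module _ {X : PROP h₃ e₃} where
      private
        module X = PROP X
        module XP = PROPProperties X

      module _ (F : A ⇒ X) (G : B ⇒ X) where
        private
          module F = _⇒_ F
          module G = _⇒_ G

          eval : ∀ {m n} → Term A B m n → X.Hom m n
          eval (inl f)  = F.map f
          eval (inr g)  = G.map g
          eval idₜ      = X.id
          eval (f ⨾ₜ g) = eval f X.⨾ eval g
          eval (f ⊕ₜ g) = eval f X.⊕ eval g
          eval (σₜ m n) = X.σ m n

          eval-cast : ∀ {m n} (p : m ≡ n) → eval (castₜ A B p) X.≈ X.cast p
          eval-cast ≡.refl = X.refl

          eval-cong : ∀ {m n} {f g : Term A B m n} → _∼_ A B f g → eval f X.≈ eval g
          eval-cong ∼-refl        = X.refl
          eval-cong (∼-sym p)     = X.sym (eval-cong p)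
          eval-cong (∼-trans p q) = X.trans (eval-cong p) (eval-cong q)
          eval-cong (⨾-cong p q)  = X.⨾-cong (eval-cong p) (eval-cong q)
          eval-cong idˡ           = X.idˡ
          eval-cong idʳ           = X.idʳ
          eval-cong assoc         = X.assoc
          eval-cong (⊕-cong p q)  = X.⊕-cong (eval-cong p) (eval-cong q)
          eval-cong ⊕-id          = X.⊕-id
          eval-cong ⊕-⨾           = X.⊕-⨾
          eval-cong ⊕-identityˡ   = X.⊕-identityˡ
          eval-cong (⊕-identityʳ {m} {n}) =
            X.trans (XP.⨾-congˡ (eval-cast (+-identityʳ n)))
              (X.trans X.⊕-identityʳ (X.sym (XP.⨾-congʳ (eval-cast (+-identityʳ m)))))
          eval-cong (⊕-assoc {m} {n} {p} {m′} {n′} {p′}) =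
            X.trans (XP.⨾-congˡ (eval-cast (+-assoc m′ n′ p′)))
              (X.trans X.⊕-assoc (X.sym (XP.⨾-congʳ (eval-cast (+-assoc m n p)))))
          eval-cong σ-natural     = X.σ-natural
          eval-cong σ-involutive  = X.σ-involutive
          eval-cong (σ-hexagon {m} {n} {p}) =
            X.trans (X.⨾-cong (eval-cast (+-assoc m n p))
                              (XP.⨾-congˡ (eval-cast (+-assoc n p m))))
              (X.trans X.σ-hexagon
                (X.sym (XP.⨾-congˡ (XP.⨾-congʳ (eval-cast (+-assoc n m p))))))
          eval-cong (inl-cong p)  = F.cong p
          eval-cong inl-id        = F.map-id
          eval-cong inl-⨾         = F.map-⨾
          eval-cong inl-⊕         = F.map-⊕
          eval-cong inl-σ         = F.map-σ
          eval-cong (inr-cong p)  = G.cong p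
          eval-cong inr-id        = G.map-id
          eval-cong inr-⨾         = G.map-⨾
          eval-cong inr-⊕         = G.map-⊕
          eval-cong inr-σ         = G.map-σ

        [_,_] : A +ᴾ B ⇒ X
        [_,_] = record { map = eval ; cong = eval-cong ; map-id = X.refl ; map-⨾ = X.refl
                       ; map-⊕ = X.refl ; map-σ = X.refl }

        []-commutes : [_,_] ∘ injˡ ≗ F × [_,_] ∘ injʳ ≗ G
        []-commutes = (λ _ → X.refl) , (λ _ → X.refl)

        []-unique : (K : A +ᴾ B ⇒ X) → K ∘ injˡ ≗ F → K ∘ injʳ ≗ G → K ≗ [_,_]
        []-unique K p q = go
          where
          module K = _⇒_ K
          go : K ≗ [_,_]
          go (inl f)  = p f
          go (inr g)  = q g
          go idₜ      = K.map-id
          go (f ⨾ₜ g) = X.trans K.map-⨾ (X.⨾-cong (go f) (go g))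
          go (f ⊕ₜ g) = X.trans K.map-⊕ (X.⊕-cong (go f) (go g))
          go (σₜ m n) = K.map-σ

open Coproduct public using (_+ᴾ_; injˡ; injʳ; [_,_])

module _ (C : PROP h e) where
  open PROP C

  record IsPullback {m n z a} (f : Hom m z) (g : Hom n z)
                    (p : Hom a m) (q : Hom a n) : Set (h ⊔ e) where
    field
      commutes : p ⨾ f ≈ q ⨾ g
      mediate  : ∀ {x} (k : Hom x m) (l : Hom x n) → k ⨾ f ≈ l ⨾ g → Hom x a
      mediate₁ : ∀ {x} {k : Hom x m} {l : Hom x n} (eq : k ⨾ f ≈ l ⨾ g) →
                 mediate k l eq ⨾ p ≈ k
      mediate₂ : ∀ {x} {k : Hom x m} {l : Hom x n} (eq : k ⨾ f ≈ l ⨾ g) →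
                 mediate k l eq ⨾ q ≈ l
      unique   : ∀ {x} {u v : Hom x a} → u ⨾ p ≈ v ⨾ p → u ⨾ q ≈ v ⨾ q → u ≈ v

  isPullback-resp : ∀ {m n z a} {f f′ : Hom m z} {g g′ : Hom n z}
                    {p p′ : Hom a m} {q q′ : Hom a n} → f ≈ f′ → g ≈ g′ → p ≈ p′ → q ≈ q′ →
                    IsPullback f g p q → IsPullback f′ g′ p′ q′
  isPullback-resp {f = f} {f′} {g} {g′} ef eg ep eq P = record
    { commutes = trans (sym (⨾-cong ep ef)) (trans commutes (⨾-cong eq eg))
    ; mediate  = λ k l r → mediate k l (back r)
    ; mediate₁ = λ r → trans (⨾-cong refl (sym ep)) (mediate₁ (back r))
    ; mediate₂ = λ r → trans (⨾-cong refl (sym eq)) (mediate₂ (back r))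
    ; unique   = λ r s → unique (trans (⨾-cong refl ep) (trans r (⨾-cong refl (sym ep))))
                                (trans (⨾-cong refl eq) (trans s (⨾-cong refl (sym eq))))
    }
    where
    open IsPullback P
    back : ∀ {x} {k : Hom x _} {l : Hom x _} → k ⨾ f′ ≈ l ⨾ g′ → k ⨾ f ≈ l ⨾ g
    back r = trans (⨾-cong refl ef) (trans r (⨾-cong refl (sym eg)))

  record Pullback {m n z} (f : Hom m z) (g : Hom n z) : Set (h ⊔ e) where
    field
      {apex}     : ℕ
      p₁         : Hom apex m
      p₂         : Hom apex n
      isPullback : IsPullback f g p₁ p₂
    open IsPullback isPullback public

  -- The second field makes ⊕ on spans functorial.
  record HasPullbacks : Set (h ⊔ e) where
    field
      pullback   : ∀ {m n z} (f : Hom m z) (g : Hom n z) → Pullback f g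
      ⊕-pullback : ∀ {m n z a m′ n′ z′ a′}
                   {f : Hom m z} {g : Hom n z} {p : Hom a m} {q : Hom a n}
                   {f′ : Hom m′ z′} {g′ : Hom n′ z′} {p′ : Hom a′ m′} {q′ : Hom a′ n′} →
                   IsPullback f g p q → IsPullback f′ g′ p′ q′ →
                   IsPullback (f ⊕ f′) (g ⊕ g′) (p ⊕ p′) (q ⊕ q′)

-- Spans are considered up to isomorphism, so the choice of pullbacks is immaterial.
-- Cospans in C are spans in C ᵒᵖ, composed by the pushouts of C.

module Spans (C : PROP h e) (pullbacks : HasPullbacks C) where
  open PROP C
  open PROPProperties C
  open HasPullbacks pullbacks

  record SpanHom (m n : ℕ) : Set h where
    constructor span
    field
      {apex} : ℕ
      left   : Hom apex m
      right  : Hom apex n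

  record _≅_ {m n} (S T : SpanHom m n) : Set (h ⊔ e) where
    private
      module S = SpanHom S
      module T = SpanHom T
    field
      to       : Hom S.apex T.apex
      from     : Hom T.apex S.apex
      inverse  : to InverseOf from
      to-left  : to ⨾ T.left ≈ S.left
      to-right : to ⨾ T.right ≈ S.right

  infix 4 _≅_

  compose : ∀ {m n p} → SpanHom m n → SpanHom n p → SpanHom m p
  compose S T = span (P.p₁ ⨾ SpanHom.left S) (P.p₂ ⨾ SpanHom.right T)
    where module P = Pullback (pullback (SpanHom.right S) (SpanHom.left T))

  tensor : ∀ {m n p q} → SpanHom m n → SpanHom p q → SpanHom (m + p) (n + q)
  tensor (span f g) (span f′ g′) = span (f ⊕ f′) (g ⊕ g′)

  graph : ∀ {m n} → Hom m n → SpanHom m n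
  graph f = span id f

  cograph : ∀ {m n} → Hom n m → SpanHom m n
  cograph f = span f id

  from-leg : ∀ {a b m} {u : Hom a b} {v : Hom b a} {f : Hom a m} {g : Hom b m} →
             u InverseOf v → u ⨾ g ≈ f → v ⨾ f ≈ g
  from-leg (_ , q) eq =
    trans (⨾-congˡ (sym eq)) (trans (sym assoc) (trans (⨾-congʳ q) idˡ))

  ≅-refl : ∀ {m n} {S : SpanHom m n} → S ≅ S
  ≅-refl = record
    { to = id ; from = id ; inverse = id-inverse ; to-left = idˡ ; to-right = idˡ }

  ≅-sym : ∀ {m n} {S T : SpanHom m n} → S ≅ T → T ≅ S
  ≅-sym i = record
    { to = from ; from = to ; inverse = proj₂ inverse , proj₁ inverse
    ; to-left = from-leg inverse to-left ; to-right = from-leg inverse to-right }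
    where open _≅_ i

  ≅-trans : ∀ {m n} {S T U : SpanHom m n} → S ≅ T → T ≅ U → S ≅ U
  ≅-trans i j = record
    { to = I.to ⨾ J.to ; from = J.from ⨾ I.from
    ; inverse = ⨾-inverse I.inverse J.inverse
    ; to-left = trans assoc (trans (⨾-congˡ J.to-left) I.to-left)
    ; to-right = trans assoc (trans (⨾-congˡ J.to-right) I.to-right) }
    where
    module I = _≅_ i
    module J = _≅_ j

  ≈⇒≅ : ∀ {a m n} {f f′ : Hom a m} {g g′ : Hom a n} → f ≈ f′ → g ≈ g′ →
        span f g ≅ span f′ g′
  ≈⇒≅ p q = record
    { to = id ; from = id ; inverse = id-inverse
    ; to-left = trans idˡ (sym p) ; to-right = trans idˡ (sym q) }

  -- any pullback computes the composite
  compose-char : ∀ {m n p a} (S : SpanHom m n) (T : SpanHom n p)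
                 {k : Hom a (SpanHom.apex S)} {l : Hom a (SpanHom.apex T)} →
                 IsPullback C (SpanHom.right S) (SpanHom.left T) k l →
                 span (k ⨾ SpanHom.left S) (l ⨾ SpanHom.right T) ≅ compose S T
  compose-char S T {k} {l} isPB = record
    { to = P.mediate k l Q.commutes
    ; from = Q.mediate P.p₁ P.p₂ P.commutes
    ; inverse =
        Q.unique (trans assoc (trans (⨾-congˡ (Q.mediate₁ _)) (trans (P.mediate₁ _) (sym idˡ))))
                 (trans assoc (trans (⨾-congˡ (Q.mediate₂ _)) (trans (P.mediate₂ _) (sym idˡ)))) ,
        P.unique (trans assoc (trans (⨾-congˡ (P.mediate₁ _)) (trans (Q.mediate₁ _) (sym idˡ))))
                 (trans assoc (trans (⨾-congˡ (P.mediate₂ _)) (trans (Q.mediate₂ _) (sym idˡ))))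
    ; to-left = trans (sym assoc) (⨾-congʳ (P.mediate₁ _))
    ; to-right = trans (sym assoc) (⨾-congʳ (P.mediate₂ _))
    }
    where
    module P = Pullback (pullback (SpanHom.right S) (SpanHom.left T))
    module Q = IsPullback isPB

  compose-cong : ∀ {m n p} {S S′ : SpanHom m n} {T T′ : SpanHom n p} →
                 S ≅ S′ → T ≅ T′ → compose S T ≅ compose S′ T′
  compose-cong {S = S} {S′} {T} {T′} i j = ≅-trans
    (≈⇒≅ (trans (⨾-congˡ (sym I.to-left)) (sym assoc))
         (trans (⨾-congˡ (sym J.to-right)) (sym assoc)))
    (compose-char S′ T′ record
      { commutes = trans assoc (trans (⨾-congˡ I.to-right) (trans P.commutes
                     (sym (trans assoc (⨾-congˡ J.to-left)))))
      ; mediate = λ k l eq → P.mediate (k ⨾ I.from) (l ⨾ J.from) (back eq)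
      ; mediate₁ = λ eq → trans (sym assoc) (trans (⨾-congʳ (P.mediate₁ (back eq)))
                     (trans assoc (trans (⨾-congˡ (proj₂ I.inverse)) idʳ)))
      ; mediate₂ = λ eq → trans (sym assoc) (trans (⨾-congʳ (P.mediate₂ (back eq)))
                     (trans assoc (trans (⨾-congˡ (proj₂ J.inverse)) idʳ)))
      ; unique = λ eq₁ eq₂ → P.unique (strip I.inverse eq₁) (strip J.inverse eq₂)
      })
    where
    module I = _≅_ i
    module J = _≅_ j
    module P = Pullback (pullback (SpanHom.right S) (SpanHom.left T))
    back : ∀ {x} {k : Hom x (SpanHom.apex S′)} {l : Hom x (SpanHom.apex T′)} →
           k ⨾ SpanHom.right S′ ≈ l ⨾ SpanHom.left T′ →
           (k ⨾ I.from) ⨾ SpanHom.right S ≈ (l ⨾ J.from) ⨾ SpanHom.left T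
    back eq = trans assoc (trans (⨾-congˡ (from-leg I.inverse I.to-right))
                (trans eq (sym (trans assoc (⨾-congˡ (from-leg J.inverse J.to-left))))))
    strip : ∀ {x a b c} {u v : Hom x a} {w : Hom a b} {s : Hom b c} {t : Hom c b} →
            s InverseOf t → u ⨾ (w ⨾ s) ≈ v ⨾ (w ⨾ s) → u ⨾ w ≈ v ⨾ w
    strip {u = u} {v} {w} {s} {t} (st , _) eq =
      trans (sym (cancel u)) (trans (⨾-congʳ eq) (cancel v))
      where
      cancel : ∀ u → (u ⨾ (w ⨾ s)) ⨾ t ≈ u ⨾ w
      cancel u = trans assoc (⨾-congˡ (trans assoc (trans (⨾-congˡ st) idʳ)))

  -- precomposing a span with the inverse of an isomorphism
  compose-iso : ∀ {m n p} {f : Hom m n} {f⁻¹ : Hom n m} {S : SpanHom n p} → f InverseOf f⁻¹ →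
                span (SpanHom.left S ⨾ f⁻¹) (SpanHom.right S) ≅ compose (graph f) S
  compose-iso {f = f} {f⁻¹} {S} (p , q) = ≅-trans (≈⇒≅ (sym idʳ) (sym idˡ))
    (compose-char (graph f) S record
      { commutes = trans assoc (trans (⨾-congˡ q) (trans idʳ (sym idˡ)))
      ; mediate = λ k l eq → l
      ; mediate₁ = λ eq → trans (sym assoc) (trans (⨾-congʳ (sym eq))
                     (trans assoc (trans (⨾-congˡ p) idʳ)))
      ; mediate₂ = λ eq → idʳ
      ; unique = λ _ eq → trans (sym idʳ) (trans eq idʳ)
      })

  compose-graph : ∀ {m n p} {S : SpanHom m n} {f : Hom n p} →
                  span (SpanHom.left S) (SpanHom.right S ⨾ f) ≅ compose S (graph f)
  compose-graph {S = S} {f} = ≅-trans (≈⇒≅ (sym idˡ) refl)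
    (compose-char S (graph f) record
      { commutes = trans idˡ (sym idʳ)
      ; mediate = λ k l eq → k
      ; mediate₁ = λ eq → idʳ
      ; mediate₂ = λ eq → trans eq idʳ
      ; unique = λ eq _ → trans (sym idʳ) (trans eq idʳ)
      })

  compose-cograph : ∀ {m n p} {S : SpanHom n p} {f : Hom n m} →
                    span (SpanHom.left S ⨾ f) (SpanHom.right S) ≅ compose (cograph f) S
  compose-cograph {S = S} {f} = ≅-trans (≈⇒≅ refl (sym idˡ))
    (compose-char (cograph f) S record
      { commutes = trans idʳ (sym idˡ)
      ; mediate = λ k l eq → l
      ; mediate₁ = λ eq → trans (sym eq) idʳ
      ; mediate₂ = λ eq → idʳ
      ; unique = λ _ eq → trans (sym idʳ) (trans eq idʳ)
      })

  graph-⨾ : ∀ {m n p} {f : Hom m n} {g : Hom n p} → graph (f ⨾ g) ≅ compose (graph f) (graph g)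
  graph-⨾ = compose-graph

  graph-cong : ∀ {m n} {f g : Hom m n} → f ≈ g → graph f ≅ graph g
  graph-cong = ≈⇒≅ refl

  graph-⊕ : ∀ {m n p q} {f : Hom m n} {g : Hom p q} → graph (f ⊕ g) ≅ tensor (graph f) (graph g)
  graph-⊕ = ≈⇒≅ (sym ⊕-id) refl

  castˢ : ∀ {m n} → m ≡ n → SpanHom m n
  castˢ {m} p = ≡.subst (SpanHom m) p (graph id)

  graph-cast : ∀ {m n} (p : m ≡ n) → graph (cast p) ≅ castˢ p
  graph-cast ≡.refl = ≅-refl

  tensor-cong : ∀ {m n p q} {S S′ : SpanHom m n} {T T′ : SpanHom p q} →
                S ≅ S′ → T ≅ T′ → tensor S T ≅ tensor S′ T′
  tensor-cong i j = record
    { to = I.to ⊕ J.to ; from = I.from ⊕ J.from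
    ; inverse = ⊕-inverse I.inverse J.inverse
    ; to-left = trans (sym ⊕-⨾) (⊕-cong I.to-left J.to-left)
    ; to-right = trans (sym ⊕-⨾) (⊕-cong I.to-right J.to-right) }
    where
    module I = _≅_ i
    module J = _≅_ j

  tensor-compose : ∀ {m n p m′ n′ p′} {S : SpanHom m n} {T : SpanHom n p}
                   {S′ : SpanHom m′ n′} {T′ : SpanHom n′ p′} →
                   tensor (compose S T) (compose S′ T′) ≅ compose (tensor S S′) (tensor T T′)
  tensor-compose {S = S} {T} {S′} {T′} = ≅-trans (≈⇒≅ ⊕-⨾ ⊕-⨾)
    (compose-char (tensor S S′) (tensor T T′)
      (⊕-pullback (Pullback.isPullback (pullback (SpanHom.right S) (SpanHom.left T)))
                  (Pullback.isPullback (pullback (SpanHom.right S′) (SpanHom.left T′)))))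

  -- both bracketings of a triple composite are limits of the same zigzag
  compose-assoc : ∀ {m n p q} {S : SpanHom m n} {T : SpanHom n p} {U : SpanHom p q} →
                  compose (compose S T) U ≅ compose S (compose T U)
  compose-assoc {S = S} {T} {U} = record
    { to = to
    ; from = from
    ; inverse =
        Q.unique (P.unique (trans (⨾-congʳ (trans assoc (⨾-congˡ from-q₁)))
                             (trans (trans assoc (trans (⨾-congˡ (P.mediate₁ _)) to-q₁′)) (idl P.p₁)))
                           (trans (⨾-congʳ (trans assoc (⨾-congˡ from-q₁)))
                             (trans (trans assoc (trans (⨾-congˡ (P.mediate₂ _)) to-q₂′p₁′))
                               (idl P.p₂))))
                 (trans assoc (trans (⨾-congˡ from-q₂) (trans to-q₂′p₂′ (sym idˡ)))) ,
        Q′.unique (trans assoc (trans (⨾-congˡ to-q₁′) (trans from-q₁p₁ (sym idˡ))))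
                  (P′.unique (trans (⨾-congʳ (trans assoc (⨾-congˡ to-q₂′)))
                               (trans (trans assoc (trans (⨾-congˡ (P′.mediate₁ _)) from-q₁p₂)) (idl P′.p₁)))
                             (trans (⨾-congʳ (trans assoc (⨾-congˡ to-q₂′)))
                               (trans (trans assoc (trans (⨾-congˡ (P′.mediate₂ _)) from-q₂)) (idl P′.p₂))))
    ; to-left = trans (sym assoc) (trans (⨾-congʳ to-q₁′) assoc)
    ; to-right = trans (⨾-congˡ (sym assoc)) (trans (sym assoc) (⨾-congʳ to-q₂′p₂′))
    }
    where
    module S = SpanHom S
    module T = SpanHom T
    module U = SpanHom U
    module P = Pullback (pullback S.right T.left)
    module Q = Pullback (pullback (P.p₂ ⨾ T.right) U.left)
    module P′ = Pullback (pullback T.right U.left)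
    module Q′ = Pullback (pullback S.right (P′.p₁ ⨾ T.left))

    idl : ∀ {a b c} {f : Hom a b} (g : Hom b c) → f ⨾ g ≈ (id ⨾ f) ⨾ g
    idl g = ⨾-congʳ (sym idˡ)

    eq₂ : (Q.p₁ ⨾ P.p₂) ⨾ T.right ≈ Q.p₂ ⨾ U.left
    eq₂ = trans assoc Q.commutes

    to₂ : Hom Q.apex P′.apex
    to₂ = P′.mediate (Q.p₁ ⨾ P.p₂) Q.p₂ eq₂

    eq₁ : (Q.p₁ ⨾ P.p₁) ⨾ S.right ≈ to₂ ⨾ (P′.p₁ ⨾ T.left)
    eq₁ = trans assoc (trans (⨾-congˡ P.commutes) (trans (sym assoc)
            (trans (⨾-congʳ (sym (P′.mediate₁ eq₂))) assoc)))

    to : Hom Q.apex Q′.apex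
    to = Q′.mediate (Q.p₁ ⨾ P.p₁) to₂ eq₁

    eq₁′ : Q′.p₁ ⨾ S.right ≈ (Q′.p₂ ⨾ P′.p₁) ⨾ T.left
    eq₁′ = trans Q′.commutes (sym assoc)

    from₁ : Hom Q′.apex P.apex
    from₁ = P.mediate Q′.p₁ (Q′.p₂ ⨾ P′.p₁) eq₁′

    eq₂′ : from₁ ⨾ (P.p₂ ⨾ T.right) ≈ (Q′.p₂ ⨾ P′.p₂) ⨾ U.left
    eq₂′ = trans (sym assoc) (trans (⨾-congʳ (P.mediate₂ eq₁′)) (trans assoc
             (trans (⨾-congˡ P′.commutes) (sym assoc))))

    from : Hom Q′.apex Q.apex
    from = Q.mediate from₁ (Q′.p₂ ⨾ P′.p₂) eq₂′

    to-q₁′ : to ⨾ Q′.p₁ ≈ Q.p₁ ⨾ P.p₁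
    to-q₁′ = Q′.mediate₁ eq₁

    to-q₂′ : to ⨾ Q′.p₂ ≈ to₂
    to-q₂′ = Q′.mediate₂ eq₁

    to-q₂′p₁′ : to ⨾ (Q′.p₂ ⨾ P′.p₁) ≈ Q.p₁ ⨾ P.p₂
    to-q₂′p₁′ = trans (sym assoc) (trans (⨾-congʳ to-q₂′) (P′.mediate₁ eq₂))

    to-q₂′p₂′ : to ⨾ (Q′.p₂ ⨾ P′.p₂) ≈ Q.p₂
    to-q₂′p₂′ = trans (sym assoc) (trans (⨾-congʳ to-q₂′) (P′.mediate₂ eq₂))

    from-q₁ : from ⨾ Q.p₁ ≈ from₁
    from-q₁ = Q.mediate₁ eq₂′

    from-q₂ : from ⨾ Q.p₂ ≈ Q′.p₂ ⨾ P′.p₂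
    from-q₂ = Q.mediate₂ eq₂′

    from-q₁p₁ : from ⨾ (Q.p₁ ⨾ P.p₁) ≈ Q′.p₁
    from-q₁p₁ = trans (sym assoc) (trans (⨾-congʳ from-q₁) (P.mediate₁ eq₁′))

    from-q₁p₂ : from ⨾ (Q.p₁ ⨾ P.p₂) ≈ Q′.p₂ ⨾ P′.p₁
    from-q₁p₂ = trans (sym assoc) (trans (⨾-congʳ from-q₁) (P.mediate₂ eq₁′))

  -- squares with casts at the bottom, lifted from the legs to spans
  cast-square : ∀ {m n p q} {S : SpanHom m n} {T : SpanHom p q} (r : m ≡ p) (s : n ≡ q)
                (t : SpanHom.apex S ≡ SpanHom.apex T) →
                SpanHom.left S ⨾ cast r ≈ cast t ⨾ SpanHom.left T →
                SpanHom.right S ⨾ cast s ≈ cast t ⨾ SpanHom.right T →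
                compose S (castˢ s) ≅ compose (castˢ r) T
  cast-square {S = S} {T} r s t left right =
    ≅-trans (≅-sym (≅-trans compose-graph (compose-cong ≅-refl (graph-cast s))))
      (≅-trans record
        { to = cast t ; from = cast (≡.sym t) ; inverse = cast-inverse t
        ; to-left = trans (sym assoc) (trans (⨾-congʳ (sym left))
                      (trans assoc (trans (⨾-congˡ (proj₁ (cast-inverse r))) idʳ)))
        ; to-right = sym right }
      (≅-trans (compose-iso (cast-inverse r)) (compose-cong (graph-cast r) ≅-refl)))

  Span : PROP h (h ⊔ e)
  Span = record
    { Hom = SpanHom
    ; _≈_ = _≅_
    ; id = graph id
    ; _⨾_ = compose
    ; _⊕_ = tensor
    ; σ = λ m n → graph (σ m n)
    ; isEquivalence = record { refl = ≅-refl ; sym = ≅-sym ; trans = ≅-trans }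
    ; ⨾-cong = compose-cong
    ; idˡ = ≅-trans (≅-sym (compose-iso id-inverse)) (≈⇒≅ idʳ refl)
    ; idʳ = ≅-trans (≅-sym compose-graph) (≈⇒≅ refl idʳ)
    ; assoc = compose-assoc
    ; ⊕-cong = tensor-cong
    ; ⊕-id = ≈⇒≅ ⊕-id ⊕-id
    ; ⊕-⨾ = tensor-compose
    ; ⊕-identityˡ = ≈⇒≅ ⊕-identityˡ ⊕-identityˡ
    ; ⊕-identityʳ = λ {m} {n} → cast-square (+-identityʳ m) (+-identityʳ n) (+-identityʳ _)
                      ⊕-identityʳ ⊕-identityʳ
    ; ⊕-assoc = λ {m} {n} {p} {m′} {n′} {p′} {S} {T} {U} →
        cast-square (+-assoc m n p) (+-assoc m′ n′ p′)
          (+-assoc (SpanHom.apex S) (SpanHom.apex T) (SpanHom.apex U)) ⊕-assoc ⊕-assoc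
    ; σ-natural = λ {f = S} {T} → ≅-trans (≅-sym compose-graph) (≅-trans record
        { to = σ (SpanHom.apex S) (SpanHom.apex T) ; from = σ (SpanHom.apex T) (SpanHom.apex S) ; inverse = σ-inverse
        ; to-left = trans (sym assoc) (trans (⨾-congʳ (sym σ-natural))
                      (trans assoc (trans (⨾-congˡ σ-involutive) idʳ)))
        ; to-right = sym σ-natural }
        (compose-iso σ-inverse))
    ; σ-involutive = ≅-trans (≅-sym graph-⨾) (graph-cong σ-involutive)
    ; σ-hexagon = λ {m} {n} {p} → ≅-trans
        (≅-sym (≅-trans graph-⨾ (compose-cong (graph-cast (+-assoc m n p))
          (≅-trans graph-⨾ (compose-cong ≅-refl (graph-cast (+-assoc n p m)))))))
        (≅-trans (graph-cong σ-hexagon)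
          (≅-trans graph-⨾ (compose-cong graph-⊕
            (≅-trans graph-⨾ (compose-cong (graph-cast (+-assoc n m p)) graph-⊕)))))
    }

  graphᴾ : C ⇒ Span
  graphᴾ = record
    { map = graph ; cong = graph-cong ; map-id = ≅-refl ; map-⨾ = graph-⨾
    ; map-⊕ = graph-⊕ ; map-σ = ≅-refl }

  cographᴾ : C ᵒᵖ ⇒ Span
  cographᴾ = record
    { map = cograph
    ; cong = λ eq → ≈⇒≅ eq refl
    ; map-id = ≅-refl
    ; map-⨾ = compose-cograph
    ; map-⊕ = ≈⇒≅ refl (sym ⊕-id)
    ; map-σ = λ {m} {n} → record
        { to = σ n m ; from = σ m n ; inverse = σ-inverse
        ; to-left = idʳ ; to-right = σ-involutive }
    }

module Matrices (R : CommutativeRing c ℓ) where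
  open CommutativeRing R hiding (zero)
    renaming (_+_ to _⊞_; +-assoc to ⊞-assoc; +-identityʳ to ⊞-identityʳ)
  open Sum semiring using (sum; sum-cong-≋; ∑-comm; *-distribˡ-sum; *-distribʳ-sum; ∑-distrib-+)
  open VecEquality setoid public using (_≋_; ≋-refl; ≋-sym; ≋-trans)

  V : ℕ → Set c
  V = Vector Carrier

  -- arrows m → n are matrices with n rows and m columns, given by their rows
  Matrix : ℕ → ℕ → Set c
  Matrix m n = Vector (V m) n

  infix 4 _≈ᴹ_
  _≈ᴹ_ : ∀ {m n} → Rel (Matrix m n) ℓ
  A ≈ᴹ B = ∀ i j → A i j ≈ B i j

  𝟎 : ∀ {n} → V n
  𝟎 = replicate _ 0#

  infixr 7 _⊙_
  _⊙_ : ∀ {n} → V n → V n → Carrier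
  x ⊙ y = sum (λ i → x i * y i)

  infixr 7 _·_
  _·_ : ∀ {m n} → Matrix m n → V m → V n
  (A · x) i = A i ⊙ x

  I : ∀ {n} → Matrix n n
  I zero    zero    = 1#
  I zero    (suc _) = 0#
  I (suc _) zero    = 0#
  I (suc i) (suc j) = I i j

  infixr 7 _⨾ᴹ_
  _⨾ᴹ_ : ∀ {m n p} → Matrix m n → Matrix n p → Matrix m p
  (A ⨾ᴹ B) i j = B i ⊙ (λ k → A k j)

  infixr 8 _⊕ᴹ_
  _⊕ᴹ_ : ∀ {m n p q} → Matrix m n → Matrix p q → Matrix (m + p) (n + q)
  A ⊕ᴹ B = (λ i → A i ++ 𝟎) ++ (λ i → 𝟎 ++ B i)

  σᴹ : ∀ m n → Matrix (m + n) (n + m)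
  σᴹ m n = (λ (i : Fin n) → 𝟎 {m} ++ I i) ++ (λ (i : Fin m) → I i ++ 𝟎 {n})

  take-++ : ∀ {m n} (x : V m) (y : V n) → take m (x ++ y) ≋ x
  take-++ {m} {n} x y i rewrite splitAt-↑ˡ m i n = refl

  drop-++ : ∀ {m n} (x : V m) (y : V n) → drop m (x ++ y) ≋ y
  drop-++ {m} {n} x y i rewrite splitAt-↑ʳ m n i = refl

  ++-cong : ∀ {m n} {x x′ : V m} {y y′ : V n} → x ≋ x′ → y ≋ y′ → x ++ y ≋ x′ ++ y′
  ++-cong {m} p q i with splitAt m i
  ... | inj₁ j = p j
  ... | inj₂ j = q j

  ++-η : ∀ m {n} (x : V (m + n)) → x ≋ take m x ++ drop m x
  ++-η m {n} x i = trans (reflexive (≡.cong x (≡.sym (join-splitAt m n i)))) go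
    where
    go : x (join m n (splitAt m i)) ≈ (take m x ++ drop m x) i
    go with splitAt m i
    ... | inj₁ j = refl
    ... | inj₂ j = refl

  ++-injective : ∀ {m n} {x x′ : V m} {y y′ : V n} → x ++ y ≋ x′ ++ y′ → x ≋ x′ × y ≋ y′
  ++-injective {m} {n} {x} {x′} {y} {y′} eq =
    ≋-trans (≋-sym (take-++ x y)) (≋-trans (λ i → eq (i ↑ˡ n)) (take-++ x′ y′)) ,
    ≋-trans (≋-sym (drop-++ x y)) (≋-trans (λ i → eq (m ↑ʳ i)) (drop-++ x′ y′))

  split-ext : ∀ {m n} {x y : V (m + n)} → take m x ≋ take m y → drop m x ≋ drop m y → x ≋ y
  split-ext {m} {x = x} {y} p q = ≋-trans (++-η m x) (≋-trans (++-cong p q) (≋-sym (++-η m y)))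

  -- x ∘ Fin.cast rebrackets the index set
  ++-suc : ∀ {m n} (x : V (suc m)) (y : V n) → (λ i → (x ++ y) (suc i)) ≋ tail x ++ y
  ++-suc {m} x y i with splitAt m i
  ... | inj₁ j = refl
  ... | inj₂ j = refl

  ++-assoc : ∀ m n p (x : V m) (y : V n) (z : V p) .(eq : m + (n + p) ≡ m + n + p) →
             (λ i → ((x ++ y) ++ z) (Fin.cast eq i)) ≋ x ++ (y ++ z)
  ++-assoc zero n p x y z eq i = reflexive (≡.cong (y ++ z) (cast-is-id eq i))
  ++-assoc (suc m) n p x y z eq zero = refl
  ++-assoc (suc m) n p x y z eq (suc i) =
    trans (++-suc (x ++ y) z _) (trans (++-cong {x′ = tail x ++ y} (++-suc x y) ≋-refl _)
      (trans (++-assoc m n p (tail x) y z (suc-injective eq) i) (sym (++-suc x (y ++ z) i))))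

  ++-identityʳ : ∀ m (x : V m) (y : V 0) .(eq : m ≡ m + 0) →
                 (λ i → (x ++ y) (Fin.cast eq i)) ≋ x
  ++-identityʳ (suc m) x y eq zero = refl
  ++-identityʳ (suc m) x y eq (suc i) =
    trans (++-suc x y _) (++-identityʳ m (tail x) y (suc-injective eq) i)

  ⊙-cong : ∀ {n} {x x′ y y′ : V n} → x ≋ x′ → y ≋ y′ → x ⊙ y ≈ x′ ⊙ y′
  ⊙-cong p q = sum-cong-≋ (λ i → *-cong (p i) (q i))

  ⊙-comm : ∀ {n} (x y : V n) → x ⊙ y ≈ y ⊙ x
  ⊙-comm x y = sum-cong-≋ (λ i → *-comm (x i) (y i))

  ⊙-𝟎ˡ : ∀ {n} (x : V n) → 𝟎 ⊙ x ≈ 0#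
  ⊙-𝟎ˡ {zero}  x = refl
  ⊙-𝟎ˡ {suc n} x = trans (+-cong (zeroˡ (x zero)) (⊙-𝟎ˡ (tail x))) (+-identityˡ 0#)

  ⊙-𝟎ʳ : ∀ {n} (x : V n) → x ⊙ 𝟎 ≈ 0#
  ⊙-𝟎ʳ x = trans (⊙-comm x 𝟎) (⊙-𝟎ˡ x)

  ⊙-++ : ∀ {m n} (a x : V m) (b y : V n) → (a ++ b) ⊙ (x ++ y) ≈ (a ⊙ x) ⊞ (b ⊙ y)
  ⊙-++ {zero}  a x b y = sym (+-identityˡ _)
  ⊙-++ {suc m} a x b y = trans
    (+-congˡ (trans (⊙-cong (++-suc a b) (++-suc x y)) (⊙-++ (tail a) (tail x) b y)))
    (sym (⊞-assoc _ _ _))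

  ⊙-+ʳ : ∀ {n} (x y z : V n) → x ⊙ (λ i → y i ⊞ z i) ≈ (x ⊙ y) ⊞ (x ⊙ z)
  ⊙-+ʳ x y z = trans (sum-cong-≋ (λ i → distribˡ (x i) (y i) (z i)))
                     (∑-distrib-+ (λ i → x i * y i) (λ i → x i * z i))

  ⊙-*ʳ : ∀ {n} r (x y : V n) → x ⊙ (λ i → r * y i) ≈ r * (x ⊙ y)
  ⊙-*ʳ r x y = trans (sum-cong-≋ (λ i → trans (sym (*-assoc _ _ _))
                       (trans (*-congʳ (*-comm (x i) r)) (*-assoc _ _ _))))
                     (sym (*-distribˡ-sum r (λ i → x i * y i)))

  ⊙-*ˡ : ∀ {n} r (x y : V n) → (λ i → r * x i) ⊙ y ≈ r * (x ⊙ y)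
  ⊙-*ˡ r x y = trans (⊙-comm _ y) (trans (⊙-*ʳ r y x) (*-congˡ (⊙-comm y x)))

  I-⊙ : ∀ {n} (i : Fin n) (x : V n) → I i ⊙ x ≈ x i
  I-⊙ zero    x = trans (+-cong (*-identityˡ _) (⊙-𝟎ˡ (tail x))) (⊞-identityʳ _)
  I-⊙ (suc i) x = trans (+-cong (zeroˡ _) (I-⊙ i (tail x))) (+-identityˡ _)

  I-sym : ∀ {n} (i j : Fin n) → I i j ≈ I j i
  I-sym zero    zero    = refl
  I-sym zero    (suc j) = refl
  I-sym (suc i) zero    = refl
  I-sym (suc i) (suc j) = I-sym i j

  record IsSubmodule {n} (M : Pred (V n) (c ⊔ ℓ)) : Set (c ⊔ ℓ) where
    field
      resp  : ∀ {x y} → x ≋ y → M x → M y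
      has-0 : M 𝟎
      add   : ∀ {x y} → M x → M y → M (λ i → x i ⊞ y i)
      scale : ∀ r {x} → M x → M (λ i → r * x i)

  ∷-ext : ∀ {n} {x y : V (suc n)} → x zero ≈ y zero → tail x ≋ tail y → x ≋ y
  ∷-ext p q zero    = p
  ∷-ext p q (suc i) = q i

  tail-submodule : ∀ {n} {M : Pred (V (suc n)) (c ⊔ ℓ)} →
                   IsSubmodule M → IsSubmodule (λ x → M (0# ∷ x))
  tail-submodule isSub = record
    { resp = λ eq → resp (∷-ext refl eq)
    ; has-0 = resp (∷-ext refl ≋-refl) has-0
    ; add = λ p q → resp (∷-ext (+-identityˡ 0#) ≋-refl) (add p q)
    ; scale = λ r p → resp (∷-ext (zeroʳ r) ≋-refl) (scale r p)
    }
    where open IsSubmodule isSub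

  -- matrices act faithfully on vectors

  ·-cong : ∀ {m n} {A B : Matrix m n} {x y : V m} → A ≈ᴹ B → x ≋ y → A · x ≋ B · y
  ·-cong p q i = ⊙-cong (p i) q

  ·-congˡ : ∀ {m n} (A : Matrix m n) {x y : V m} → x ≋ y → A · x ≋ A · y
  ·-congˡ A = ·-cong {A = A} (λ i j → refl)

  ·-congʳ : ∀ {m n} {A B : Matrix m n} {x : V m} → A ≈ᴹ B → A · x ≋ B · x
  ·-congʳ p = ·-cong p ≋-refl

  ·-ext : ∀ {m n} {A B : Matrix m n} → (∀ x → A · x ≋ B · x) → A ≈ᴹ B
  ·-ext {A = A} {B} eq i j =
    trans (sym (I-⊙ j (A i))) (trans (⊙-comm (I j) (A i)) (trans (eq (I j) i)
      (trans (⊙-comm (B i) (I j)) (I-⊙ j (B i)))))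

  ·-ext₂ : ∀ {m n p} {A B : Matrix (m + n) p} →
           (∀ (x : V m) (y : V n) → A · (x ++ y) ≋ B · (x ++ y)) → A ≈ᴹ B
  ·-ext₂ {m} {A = A} {B} eq = ·-ext λ x →
    ≋-trans (·-congˡ A (++-η m x)) (≋-trans (eq _ _) (≋-sym (·-congˡ B (++-η m x))))

  ·-I : ∀ {n} (x : V n) → I · x ≋ x
  ·-I x i = I-⊙ i x

  ·-⨾ : ∀ {m n p} (A : Matrix m n) (B : Matrix n p) (x : V m) → (A ⨾ᴹ B) · x ≋ B · (A · x)
  ·-⨾ A B x i = begin
    sum (λ j → sum (λ k → B i k * A k j) * x j)
      ≈⟨ sum-cong-≋ (λ j → *-distribʳ-sum (x j) (λ k → B i k * A k j)) ⟩
    sum (λ j → sum (λ k → (B i k * A k j) * x j))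
      ≈⟨ ∑-comm (λ j k → (B i k * A k j) * x j) ⟩
    sum (λ k → sum (λ j → (B i k * A k j) * x j))
      ≈⟨ sum-cong-≋ (λ k → sum-cong-≋ (λ j → *-assoc (B i k) (A k j) (x j))) ⟩
    sum (λ k → sum (λ j → B i k * (A k j * x j)))
      ≈⟨ sum-cong-≋ (λ k → *-distribˡ-sum (B i k) (λ j → A k j * x j)) ⟨
    sum (λ k → B i k * sum (λ j → A k j * x j)) ∎
    where open SetoidReasoning setoid

  stack-· : ∀ {m n p} (A : Matrix m n) (B : Matrix m p) (x : V m) →
            (A ++ B) · x ≋ (A · x) ++ (B · x)
  stack-· {n = n} A B x i with splitAt n i
  ... | inj₁ j = refl
  ... | inj₂ j = refl

  ·-⊕ : ∀ {m n p q} (A : Matrix m n) (B : Matrix p q) (x : V m) (y : V p) →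
        (A ⊕ᴹ B) · (x ++ y) ≋ (A · x) ++ (B · y)
  ·-⊕ A B x y = ≋-trans (stack-· (λ i → A i ++ 𝟎) (λ i → 𝟎 ++ B i) (x ++ y)) (++-cong
    (λ i → trans (⊙-++ (A i) x 𝟎 y) (trans (+-congˡ (⊙-𝟎ˡ y)) (⊞-identityʳ _)))
    (λ i → trans (⊙-++ 𝟎 x (B i) y) (trans (+-congʳ (⊙-𝟎ˡ x)) (+-identityˡ _))))

  ·-σ : ∀ {m n} (x : V m) (y : V n) → σᴹ m n · (x ++ y) ≋ y ++ x
  ·-σ {m} {n} x y = ≋-trans
    (stack-· (λ (i : Fin n) → 𝟎 {m} ++ I i) (λ (i : Fin m) → I i ++ 𝟎 {n}) (x ++ y)) (++-cong
    (λ i → trans (⊙-++ 𝟎 x (I i) y) (trans (+-cong (⊙-𝟎ˡ x) (I-⊙ i y)) (+-identityˡ _)))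
    (λ i → trans (⊙-++ (I i) x 𝟎 y) (trans (+-cong (I-⊙ i x) (⊙-𝟎ˡ y)) (⊞-identityʳ _))))

  castᴹ : ∀ {m n} → m ≡ n → Matrix m n
  castᴹ {m} p = ≡.subst (Matrix m) p I

  ·-cast : ∀ {m n} (p : m ≡ n) (x : V m) → castᴹ p · x ≋ (λ i → x (Fin.cast (≡.sym p) i))
  ·-cast ≡.refl x i = trans (I-⊙ i x) (reflexive (≡.cong x (≡.sym (cast-is-id ≡.refl i))))

  ⊕-cast : ∀ {m n} p (x : V m) (y : V n) (z : V p) →
           castᴹ (+-assoc m n p) · ((x ++ y) ++ z) ≋ x ++ (y ++ z)
  ⊕-cast {m} {n} p x y z =
    ≋-trans (·-cast (+-assoc m n p) ((x ++ y) ++ z)) (++-assoc m n p x y z _)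

  0-cast : ∀ {m} (x : V m) (y : V 0) → castᴹ (+-identityʳ m) · (x ++ y) ≋ x
  0-cast {m} x y = ≋-trans (·-cast (+-identityʳ m) (x ++ y)) (++-identityʳ m x y _)

  ·-⨾₂ : ∀ {m n p} (A : Matrix m n) (B : Matrix n p) {x y z} →
         A · x ≋ y → B · y ≋ z → (A ⨾ᴹ B) · x ≋ z
  ·-⨾₂ A B {x} p q = ≋-trans (·-⨾ A B x) (≋-trans (·-congˡ B p) q)

  ·-⊕₂ : ∀ {m n p q} (A : Matrix m n) (B : Matrix p q) {x y z w} →
         A · x ≋ z → B · y ≋ w → (A ⊕ᴹ B) · (x ++ y) ≋ z ++ w
  ·-⊕₂ A B {x} {y} p q = ≋-trans (·-⊕ A B x y) (++-cong p q)

  ⨾ᴹ-cong : ∀ {m n p} {A A′ : Matrix m n} {B B′ : Matrix n p} →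
            A ≈ᴹ A′ → B ≈ᴹ B′ → A ⨾ᴹ B ≈ᴹ A′ ⨾ᴹ B′
  ⨾ᴹ-cong p q i j = ⊙-cong (q i) (λ k → p k j)

  ⊕ᴹ-cong : ∀ {m n p q} {A A′ : Matrix m n} {B B′ : Matrix p q} →
            A ≈ᴹ A′ → B ≈ᴹ B′ → A ⊕ᴹ B ≈ᴹ A′ ⊕ᴹ B′
  ⊕ᴹ-cong {n = n} p q i with splitAt n i
  ... | inj₁ j = ++-cong (p j) ≋-refl
  ... | inj₂ j = ++-cong (≋-refl {x = 𝟎}) (q j)

  Mat : PROP c ℓ
  Mat = record
    { Hom = Matrix
    ; _≈_ = _≈ᴹ_
    ; id = I
    ; _⨾_ = _⨾ᴹ_
    ; _⊕_ = _⊕ᴹ_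
    ; σ = σᴹ
    ; isEquivalence = record
        { refl = λ i j → refl
        ; sym = λ p i j → sym (p i j)
        ; trans = λ p q i j → trans (p i j) (q i j) }
    ; ⨾-cong = ⨾ᴹ-cong
    ; idˡ = λ {f = A} → ·-ext λ x → ·-⨾₂ I A (·-I x) ≋-refl
    ; idʳ = λ {f = A} → ·-ext λ x → ·-⨾₂ A I ≋-refl (·-I (A · x))
    ; assoc = λ {f = A} {B} {C} → ·-ext λ x → ·-⨾₂ (A ⨾ᴹ B) C (·-⨾ A B x)
        (≋-sym (·-⨾₂ A (B ⨾ᴹ C) ≋-refl (·-⨾ B C (A · x))))
    ; ⊕-cong = ⊕ᴹ-cong
    ; ⊕-id = λ {m} {n} → ·-ext₂ λ x y →
        ≋-trans (·-⊕₂ (I {m}) (I {n}) (·-I x) (·-I y)) (≋-sym (·-I (x ++ y)))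
    ; ⊕-⨾ = λ {f = A} {B} {A′} {B′} → ·-ext₂ λ x y →
        ≋-trans (·-⊕₂ (A ⨾ᴹ B) (A′ ⨾ᴹ B′) (·-⨾ A B x) (·-⨾ A′ B′ y))
          (≋-sym (·-⨾₂ (A ⊕ᴹ A′) (B ⊕ᴹ B′) (·-⊕ A A′ x y) (·-⊕ B B′ (A · x) (A′ · y))))
    ; ⊕-identityˡ = λ i j → refl
    ; ⊕-identityʳ = λ {m} {n} {A} → ·-ext₂ λ x y →
        ≋-trans (·-⨾₂ (A ⊕ᴹ I) (castᴹ (+-identityʳ n)) (·-⊕ A I x y) (0-cast (A · x) (I · y)))
          (≋-sym (·-⨾₂ (castᴹ (+-identityʳ m)) A (0-cast x y) ≋-refl))
    ; ⊕-assoc = λ {m} {n} {p} {m′} {n′} {p′} {A} {B} {C} → ·-ext₂ λ xy z →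
        let x = take m xy
            y = drop m xy
            w = ++-cong (++-η m xy) (≋-refl {x = z})
            L = ((A ⊕ᴹ B) ⊕ᴹ C) ⨾ᴹ castᴹ (+-assoc m′ n′ p′)
            R = castᴹ (+-assoc m n p) ⨾ᴹ (A ⊕ᴹ (B ⊕ᴹ C))
        in ≋-trans (·-congˡ L w) (≋-trans
             (·-⨾₂ ((A ⊕ᴹ B) ⊕ᴹ C) (castᴹ (+-assoc m′ n′ p′))
               (·-⊕₂ (A ⊕ᴹ B) C (·-⊕ A B x y) ≋-refl) (⊕-cast p′ (A · x) (B · y) (C · z)))
             (≋-sym (≋-trans (·-congˡ R w) (·-⨾₂ (castᴹ (+-assoc m n p)) (A ⊕ᴹ (B ⊕ᴹ C))
               (⊕-cast p x y z) (·-⊕₂ A (B ⊕ᴹ C) ≋-refl (·-⊕ B C y z))))))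
    ; σ-natural = λ {m} {n} {m′} {n′} {A} {B} → ·-ext₂ λ x y →
        ≋-trans (·-⨾₂ (A ⊕ᴹ B) (σᴹ m′ n′) (·-⊕ A B x y) (·-σ (A · x) (B · y)))
          (≋-sym (·-⨾₂ (σᴹ m n) (B ⊕ᴹ A) (·-σ x y) (·-⊕ B A y x)))
    ; σ-involutive = λ {m} {n} → ·-ext₂ {m} {n} λ x y →
        ≋-trans (·-⨾₂ (σᴹ m n) (σᴹ n m) (·-σ x y) (·-σ y x)) (≋-sym (·-I (x ++ y)))
    ; σ-hexagon = λ {m} {n} {p} → ·-ext₂ λ xy z →
        let x = take m xy
            y = drop m xy
            w = ++-cong (++-η m xy) (≋-refl {x = z})
            L₁ = σᴹ m (n + p) ⨾ᴹ castᴹ (+-assoc n p m)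
            R₁ = castᴹ (+-assoc n m p) ⨾ᴹ (I {n} ⊕ᴹ σᴹ m p)
            L = castᴹ (+-assoc m n p) ⨾ᴹ L₁
            R = (σᴹ m n ⊕ᴹ I {p}) ⨾ᴹ R₁
        in ≋-trans (·-congˡ L w) (≋-trans
             (·-⨾₂ (castᴹ (+-assoc m n p)) L₁ (⊕-cast p x y z)
               (·-⨾₂ (σᴹ m (n + p)) (castᴹ (+-assoc n p m)) (·-σ x (y ++ z)) (⊕-cast m y z x)))
             (≋-sym (≋-trans (·-congˡ R w)
               (·-⨾₂ (σᴹ m n ⊕ᴹ I {p}) R₁ (·-⊕₂ (σᴹ m n) (I {p}) (·-σ x y) (·-I z))
                 (·-⨾₂ (castᴹ (+-assoc n m p)) (I {n} ⊕ᴹ σᴹ m p) (⊕-cast p y x z)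
                   (·-⊕₂ (I {n}) (σᴹ m p) (·-I y) (·-σ x z)))))))
    }

  -- transposition is an isomorphism of Mat with its opposite

  ⨾-transpose : ∀ {m n p} (A : Matrix m n) (B : Matrix n p) →
                transpose (A ⨾ᴹ B) ≈ᴹ transpose B ⨾ᴹ transpose A
  ⨾-transpose A B i j = ⊙-comm (B j) (λ k → A k i)

  ⊕-transpose : ∀ {m n p q} (A : Matrix m n) (B : Matrix p q) →
                transpose (A ⊕ᴹ B) ≈ᴹ transpose A ⊕ᴹ transpose B
  ⊕-transpose {m} {n} A B i j with splitAt m i in eqᵢ | splitAt n j in eqⱼ
  ... | inj₁ _ | inj₁ _ rewrite eqᵢ | eqⱼ = refl
  ... | inj₁ _ | inj₂ _ rewrite eqᵢ | eqⱼ = refl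
  ... | inj₂ _ | inj₁ _ rewrite eqᵢ | eqⱼ = refl
  ... | inj₂ _ | inj₂ _ rewrite eqᵢ | eqⱼ = refl

  -- pullbacks in Mat, tested on vectors

  record IsVecPullback {m n z a} (f : Matrix m z) (g : Matrix n z)
                       (p : Matrix a m) (q : Matrix a n) : Set (c ⊔ ℓ) where
    field
      commutes : ∀ x → f · (p · x) ≋ g · (q · x)
      mediate  : ∀ x y → f · x ≋ g · y → ∃ λ w → p · w ≋ x × q · w ≋ y
      unique   : ∀ {u v} → p · u ≋ p · v → q · u ≋ q · v → u ≋ v

  module _ {m n z a} {f : Matrix m z} {g : Matrix n z} {p : Matrix a m} {q : Matrix a n} where

    toPullback : IsVecPullback f g p q → IsPullback Mat f g p q
    toPullback P = record
      { commutes = ·-ext λ x → ≋-trans (·-⨾ p f x) (≋-trans (commutes x) (≋-sym (·-⨾ q g x)))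
      ; mediate = λ k l eq i j → proj₁ (mediate (λ t → k t j) (λ t → l t j) (λ t → eq t j)) i
      ; mediate₁ = λ eq i j → proj₁ (proj₂ (mediate _ _ (λ t → eq t j))) i
      ; mediate₂ = λ eq i j → proj₂ (proj₂ (mediate _ _ (λ t → eq t j))) i
      ; unique = λ eq₁ eq₂ i j → unique (λ t → eq₁ t j) (λ t → eq₂ t j) i
      }
      where open IsVecPullback P

    fromPullback : IsPullback Mat f g p q → IsVecPullback f g p q
    fromPullback P = record
      { commutes = λ x → ≋-trans (≋-sym (·-⨾ p f x)) (≋-trans (·-congʳ commutes) (·-⨾ q g x))
      ; mediate = λ x y eq → let eq′ = λ i (_ : Fin 1) → eq i in
          (λ i → mediate (λ i _ → x i) (λ i _ → y i) eq′ i zero) ,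
          (λ i → mediate₁ eq′ i zero) , (λ i → mediate₂ eq′ i zero)
      ; unique = λ {u} {v} eq₁ eq₂ i →
          unique {x = 1} {λ i _ → u i} {λ i _ → v i} (λ i _ → eq₁ i) (λ i _ → eq₂ i) i zero
      }
      where open IsPullback P

  ⊕-take : ∀ {m n p q} (A : Matrix m n) (B : Matrix p q) (x : V (m + p)) →
           take n ((A ⊕ᴹ B) · x) ≋ A · take m x
  ⊕-take {m} A B x = ≋-trans (λ i → ≋-trans (·-congˡ (A ⊕ᴹ B) (++-η m x)) (·-⊕ A B _ _) (i ↑ˡ _))
                             (take-++ (A · take m x) (B · drop m x))

  ⊕-drop : ∀ {m n p q} (A : Matrix m n) (B : Matrix p q) (x : V (m + p)) →
           drop n ((A ⊕ᴹ B) · x) ≋ B · drop m x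
  ⊕-drop {m} {n} A B x = ≋-trans (λ i → ≋-trans (·-congˡ (A ⊕ᴹ B) (++-η m x)) (·-⊕ A B _ _) (n ↑ʳ i))
                             (drop-++ (A · take m x) (B · drop m x))

  ⊕-vecPullback : ∀ {m n z a m′ n′ z′ a′}
    {f : Matrix m z} {g : Matrix n z} {p : Matrix a m} {q : Matrix a n}
    {f′ : Matrix m′ z′} {g′ : Matrix n′ z′} {p′ : Matrix a′ m′} {q′ : Matrix a′ n′} →
    IsVecPullback f g p q → IsVecPullback f′ g′ p′ q′ →
    IsVecPullback (f ⊕ᴹ f′) (g ⊕ᴹ g′) (p ⊕ᴹ p′) (q ⊕ᴹ q′)
  ⊕-vecPullback {m} {n} {z} {a} {f = f} {g} {p} {q} {f′} {g′} {p′} {q′} P P′ = record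
    { commutes = λ x → split-ext {z}
        (≋-trans (⊕-take f f′ _) (≋-trans (·-congˡ f (⊕-take p p′ x)) (≋-trans (P.commutes (take a x))
          (≋-sym (≋-trans (⊕-take g g′ _) (·-congˡ g (⊕-take q q′ x)))))))
        (≋-trans (⊕-drop f f′ _) (≋-trans (·-congˡ f′ (⊕-drop p p′ x)) (≋-trans (P′.commutes (drop a x))
          (≋-sym (≋-trans (⊕-drop g g′ _) (·-congˡ g′ (⊕-drop q q′ x)))))))
    ; mediate = λ x y eq →
        let (w , wx , wy) = P.mediate (take m x) (take n y)
              (≋-trans (≋-sym (⊕-take f f′ x)) (≋-trans (λ i → eq (i ↑ˡ _)) (⊕-take g g′ y)))
            (w′ , wx′ , wy′) = P′.mediate (drop m x) (drop n y)
              (≋-trans (≋-sym (⊕-drop f f′ x)) (≋-trans (λ i → eq (z ↑ʳ i)) (⊕-drop g g′ y)))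
        in w ++ w′ ,
           ≋-trans (·-⊕ p p′ w w′) (≋-trans (++-cong wx wx′) (≋-sym (++-η m x))) ,
           ≋-trans (·-⊕ q q′ w w′) (≋-trans (++-cong wy wy′) (≋-sym (++-η n y)))
    ; unique = λ {u} {v} eq₁ eq₂ → split-ext {a}
        (P.unique
          (≋-trans (≋-sym (⊕-take p p′ u)) (≋-trans (λ i → eq₁ (i ↑ˡ _)) (⊕-take p p′ v)))
          (≋-trans (≋-sym (⊕-take q q′ u)) (≋-trans (λ i → eq₂ (i ↑ˡ _)) (⊕-take q q′ v))))
        (P′.unique
          (≋-trans (≋-sym (⊕-drop p p′ u)) (≋-trans (λ i → eq₁ (m ↑ʳ i)) (⊕-drop p p′ v)))
          (≋-trans (≋-sym (⊕-drop q q′ u)) (≋-trans (λ i → eq₂ (n ↑ʳ i)) (⊕-drop q q′ v))))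
    }
    where
    module P = IsVecPullback P
    module P′ = IsVecPullback P′

  module _ {m n z a} {f : Matrix m z} {g : Matrix n z} {p : Matrix a m} {q : Matrix a n} where

    toPushout : IsPullback Mat f g p q →
                IsPullback (Mat ᵒᵖ) (transpose f) (transpose g) (transpose p) (transpose q)
    toPushout P = record
      { commutes = λ i j → trans (sym (⨾-transpose p f i j)) (trans (commutes j i) (⨾-transpose q g i j))
      ; mediate = λ k l eq → transpose (mediate (transpose k) (transpose l) (flip eq))
      ; mediate₁ = λ {x} {k} eq i j →
          trans (sym (⨾-transpose (mediate _ _ (flip eq)) p i j)) (mediate₁ (flip eq) j i)
      ; mediate₂ = λ {x} {k} eq i j →
          trans (sym (⨾-transpose (mediate _ _ (flip eq)) q i j)) (mediate₂ (flip eq) j i)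
      ; unique = λ {x} {u} {v} eq₁ eq₂ i j → unique {u = transpose u} {transpose v}
          (λ i j → trans (sym (⨾-transpose p′ u i j)) (trans (eq₁ j i) (⨾-transpose p′ v i j)))
          (λ i j → trans (sym (⨾-transpose q′ u i j)) (trans (eq₂ j i) (⨾-transpose q′ v i j))) j i
      }
      where
      open IsPullback P
      p′ = transpose p
      q′ = transpose q
      flip : ∀ {x} {k : Matrix m x} {l : Matrix n x} →
             transpose f ⨾ᴹ k ≈ᴹ transpose g ⨾ᴹ l → transpose k ⨾ᴹ f ≈ᴹ transpose l ⨾ᴹ g
      flip {x} {k} {l} eq i j = trans (sym (⨾-transpose (transpose f) k i j))
        (trans (eq j i) (⨾-transpose (transpose g) l i j))

    fromPushout : IsPullback (Mat ᵒᵖ) (transpose f) (transpose g) (transpose p) (transpose q) →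
                  IsPullback Mat f g p q
    fromPushout P = record
      { commutes = λ i j → trans (⨾-transpose p f j i) (trans (commutes j i) (sym (⨾-transpose q g j i)))
      ; mediate = λ k l eq → transpose (mediate (transpose k) (transpose l) (flip eq))
      ; mediate₁ = λ eq i j → trans (⨾-transpose (transpose (mediate _ _ (flip eq))) p j i) (mediate₁ (flip eq) j i)
      ; mediate₂ = λ eq i j → trans (⨾-transpose (transpose (mediate _ _ (flip eq))) q j i) (mediate₂ (flip eq) j i)
      ; unique = λ {x} {u} {v} eq₁ eq₂ i j → unique {u = transpose u} {transpose v}
          (λ i j → trans (sym (⨾-transpose u p i j)) (trans (eq₁ j i) (⨾-transpose v p i j)))
          (λ i j → trans (sym (⨾-transpose u q i j)) (trans (eq₂ j i) (⨾-transpose v q i j))) j i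
      }
      where
      open IsPullback P
      flip : ∀ {x} {k : Matrix x m} {l : Matrix x n} →
             k ⨾ᴹ f ≈ᴹ l ⨾ᴹ g → transpose f ⨾ᴹ transpose k ≈ᴹ transpose g ⨾ᴹ transpose l
      flip {x} {k} {l} eq i j = trans (sym (⨾-transpose k f i j)) (trans (eq j i) (⨾-transpose l g i j))

module _ (R : CommutativeRing c ℓ) where
  open CommutativeRing R hiding (zero) renaming (_+_ to _⊞_)

  record IsIdeal {p} (I : Pred Carrier p) : Set (c ⊔ ℓ ⊔ p) where
    field
      resp   : ∀ {x y} → x ≈ y → I x → I y
      has-0  : I 0#
      add    : ∀ {x y} → I x → I y → I (x ⊞ y)
      absorb : ∀ r {x} → I x → I (r * x)

  -- This is the classical notion: it says that every ideal has a generator,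
  -- including { x ∣ x ≈ 0 or P }, whose generator decides the proposition P.
  record IsPID : Set (lsuc (c ⊔ ℓ)) where
    field
      1≉0            : 1# ≉ 0#
      noZeroDivisors : ∀ {x y} → x * y ≈ 0# → x ≈ 0# ⊎ y ≈ 0#
      principal      : (I : Pred Carrier (c ⊔ ℓ)) → IsIdeal I →
                       ∃ λ g → I ≐ (λ x → ∃ λ r → r * g ≈ x)

  record IsField : Set (c ⊔ ℓ) where
    field
      1≉0     : 1# ≉ 0#
      inverse : ∀ {x} → x ≉ 0# → ∃ λ y → y * x ≈ 1#

record IsFieldOfFractions (R : CommutativeRing c ℓ) (k : CommutativeRing c′ ℓ′)
  (⟦_⟧ : CommutativeRing.Carrier R → CommutativeRing.Carrier k) : Set (c ⊔ ℓ ⊔ c′ ⊔ ℓ′) where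
  private
    module R = CommutativeRing R
    module k = CommutativeRing k
  field
    isField        : IsField k
    isMonomorphism : IsRingMonomorphism R.rawRing k.rawRing ⟦_⟧
    fraction       : ∀ x → ∃₂ λ a b → b R.≉ R.0# × x k.* ⟦ b ⟧ k.≈ ⟦ a ⟧

module PID {R : CommutativeRing c ℓ} (isPID : IsPID R) where
  open CommutativeRing R hiding (zero) renaming (_+_ to _⊞_; +-assoc to ⊞-assoc; +-identityʳ to ⊞-identityʳ)
  open IsPID isPID
  open RingProperties ring using ([y-z]x≈yx-zx; -1*x≈-x; x∙y⁻¹≈ε⇒x≈y; x≈y⇒x∙y⁻¹≈ε)
  open Matrices R

  dec : (P : Set (c ⊔ ℓ)) → Dec P
  dec P with principal J isIdeal
    where
    J : Pred Carrier (c ⊔ ℓ)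
    J x = Lift c (x ≈ 0#) ⊎ P

    isIdeal : IsIdeal R J
    isIdeal = record
      { resp = λ { eq (inj₁ (lift p)) → inj₁ (lift (trans (sym eq) p)) ; eq (inj₂ p) → inj₂ p }
      ; has-0 = inj₁ (lift refl)
      ; add = λ { (inj₁ (lift p)) (inj₁ (lift q)) → inj₁ (lift (trans (+-cong p q) (+-identityˡ 0#)))
                ; (inj₁ _) (inj₂ q) → inj₂ q ; (inj₂ p) _ → inj₂ p }
      ; absorb = λ { r (inj₁ (lift p)) → inj₁ (lift (trans (*-congˡ p) (zeroʳ r)))
                   ; r (inj₂ p) → inj₂ p }
      }
  ... | g , ⊆ , ⊇ with ⊇ (1# , *-identityˡ g)
  ...   | inj₂ p = yes p
  ...   | inj₁ (lift g≈0) = no λ p → let (r , eq) = ⊆ {1#} (inj₂ p) in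
            1≉0 (trans (sym eq) (trans (*-congˡ g≈0) (zeroʳ r)))

  *-cancelʳ : ∀ {x y g} → g ≉ 0# → x * g ≈ y * g → x ≈ y
  *-cancelʳ {x} {y} {g} g≉0 eq
    with noZeroDivisors {x - y} {g} (trans ([y-z]x≈yx-zx g x y) (x≈y⇒x∙y⁻¹≈ε eq))
  ... | inj₂ g≈0   = contradiction g≈0 g≉0
  ... | inj₁ x-y≈0 = x∙y⁻¹≈ε⇒x≈y x y x-y≈0

  -- Submodules of R^n are free of finite rank.

  record Basis {n} (M : Pred (V n) (c ⊔ ℓ)) : Set (c ⊔ ℓ) where
    field
      {rank}      : ℕ
      matrix      : Matrix rank n
      member      : ∀ z → M (matrix · z)
      spanning    : ∀ {x} → M x → ∃ λ z → matrix · z ≋ x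
      independent : ∀ {u v} → matrix · u ≋ matrix · v → u ≋ v

  basis : ∀ {n} (M : Pred (V n) (c ⊔ ℓ)) → IsSubmodule M → Basis M
  basis {zero} M isSub = record
    { matrix = λ ()
    ; member = λ z → resp (λ ()) has-0
    ; spanning = λ _ → (λ ()) , (λ ())
    ; independent = λ {u} {v} _ → no-index {u = u} {v}
    }
    where
    open IsSubmodule isSub
    no-index : {u v : V 0} → u ≋ v
    no-index ()
  basis {suc n} M isSub = extend (principal J isIdeal)
    where
    open IsSubmodule isSub

    J : Pred Carrier (c ⊔ ℓ)
    J r = ∃ λ v → M v × v zero ≈ r

    isIdeal : IsIdeal R J
    isIdeal = record
      { resp = λ { eq (v , m , p) → v , m , trans p eq }
      ; has-0 = 𝟎 , has-0 , refl
      ; add = λ { (v , m , p) (w , m′ , q) → _ , add m m′ , +-cong p q }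
      ; absorb = λ { r (v , m , p) → _ , scale r m , *-congˡ p }
      }

    M′ : Pred (V n) (c ⊔ ℓ)
    M′ x = M (0# ∷ x)

    B′ : Basis M′
    B′ = basis M′ (tail-submodule isSub)
    module B′ = Basis B′

    extend : (∃ λ g → J ≐ (λ x → ∃ λ r → r * g ≈ x)) → Basis M
    extend (g , ⊆ , ⊇) with ⊇ (1# , *-identityˡ g) | dec (Lift c (g ≈ 0#))
    ... | _ | yes (lift g≈0) = record
      { matrix = 𝟎 ∷ B′.matrix
      ; member = λ z → resp (∷-ext (sym (⊙-𝟎ˡ z)) (λ _ → refl)) (B′.member z)
      ; spanning = λ {x} m →
          let (r , eq) = ⊆ (x , m , refl)
              x₀≈0 = trans (sym eq) (trans (*-congˡ g≈0) (zeroʳ r))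
              (z , eq′) = B′.spanning (resp (∷-ext x₀≈0 (λ _ → refl)) m)
          in z , ∷-ext (trans (⊙-𝟎ˡ z) (sym x₀≈0)) eq′
      ; independent = λ eq → B′.independent (λ i → eq (suc i))
      }
    ... | v , v∈M , v₀≈g | no g≉0 = record
      { matrix = matrix
      ; member = λ z → resp (≋-sym (action z)) (add (scale (z zero) v∈M) (B′.member (tail z)))
      ; spanning = λ {x} m →
          let (r , eq) = ⊆ (x , m , refl)
              d = λ i → x i ⊞ (- r) * v i
              (z , eq′) = B′.spanning {tail d} (resp (∷-ext (head-zero r eq) (λ _ → refl)) (add m (scale (- r) v∈M)))
          in r ∷ z , ≋-trans (action (r ∷ z)) (∷-ext
               (trans (⊞-identityʳ _) (trans (*-congˡ v₀≈g) eq))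
               (λ i → trans (+-congˡ (eq′ i)) (restore r (v (suc i)) (x (suc i)))))
      ; independent = λ {u} {w} eq →
          let eq₀ = *-cancelʳ {g = v zero} (λ p → g≉0 (lift (trans (sym v₀≈g) p)))
                      (trans (sym (⊞-identityʳ _)) (trans (sym (action u zero))
                        (trans (eq zero) (trans (action w zero) (⊞-identityʳ _)))))
          in λ { zero → eq₀ ; (suc i) → B′.independent {tail u} {tail w} (λ j → +-cancelˡ _ _ _
                 (trans (sym (action u (suc j))) (trans (eq (suc j)) (trans (action w (suc j))
                   (+-congʳ (*-congʳ (sym eq₀))))))) i }
      }
      where
      open RingProperties ring using (-‿distribˡ-*; +-cancelˡ)
      matrix : Matrix (suc B′.rank) (suc n)
      matrix i = v i ∷ (𝟎 ∷ B′.matrix) i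

      action : ∀ z → matrix · z ≋ (λ i → z zero * v i ⊞ (0# ∷ (B′.matrix · tail z)) i)
      action z zero    = +-cong (*-comm _ _) (⊙-𝟎ˡ (tail z))
      action z (suc i) = +-congʳ (*-comm _ _)

      cancel : ∀ r y → r * y ⊞ (- r) * y ≈ 0#
      cancel r y = trans (+-congˡ (sym (-‿distribˡ-* r y))) (-‿inverseʳ _)

      head-zero : ∀ r {y} → r * g ≈ y → y ⊞ (- r) * v zero ≈ 0#
      head-zero r eq = trans (+-congʳ (trans (sym eq) (*-congˡ (sym v₀≈g)))) (cancel r (v zero))

      restore : ∀ r y x → r * y ⊞ (x ⊞ (- r) * y) ≈ x
      restore r y x = trans (+-comm _ _) (trans (⊞-assoc x _ _) (trans
        (+-congˡ (trans (+-comm _ _) (cancel r y))) (⊞-identityʳ x)))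

  -- the pullback of f and g is a basis of { (x , y) ∣ f x ≈ g y }

  vecPullback : ∀ {m n z} (f : Matrix m z) (g : Matrix n z) →
                Σ[ a ∈ ℕ ] Σ[ p ∈ Matrix a m ] Σ[ q ∈ Matrix a n ] IsVecPullback f g p q
  vecPullback {m} {n} {z} f g = rank , take m matrix , drop m matrix , record
    { commutes = λ x → lower (member x)
    ; mediate = λ x y eq →
        let (w , eq′) = spanning {x ++ y} (lift (≋-trans (·-congˡ f (take-++ x y))
                          (≋-trans eq (≋-sym (·-congˡ g (drop-++ x y))))))
        in w , ≋-trans (λ i → eq′ (i ↑ˡ n)) (take-++ x y) ,
               ≋-trans (λ i → eq′ (m ↑ʳ i)) (drop-++ x y)
    ; unique = λ p q → independent (split-ext {m} p q)
    }
    where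
    M : Pred (V (m + n)) (c ⊔ ℓ)
    M x = Lift c (f · take m x ≋ g · drop m x)

    isSub : IsSubmodule M
    isSub = record
      { resp = λ { eq (lift p) → lift (≋-trans (·-congˡ f (λ i → sym (eq (i ↑ˡ n))))
                     (≋-trans p (·-congˡ g (λ i → eq (m ↑ʳ i))))) }
      ; has-0 = lift (λ i → trans (⊙-𝟎ʳ (f i)) (sym (⊙-𝟎ʳ (g i))))
      ; add = λ { (lift p) (lift q) → lift (λ i → trans (⊙-+ʳ (f i) _ _)
                    (trans (+-cong (p i) (q i)) (sym (⊙-+ʳ (g i) _ _)))) }
      ; scale = λ { r (lift p) → lift (λ i → trans (⊙-*ʳ r (f i) _)
                    (trans (*-congˡ (p i)) (sym (⊙-*ʳ r (g i) _)))) }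
      }

    open Basis (basis M isSub)

  hasPullbacks : HasPullbacks Mat
  hasPullbacks = record
    { pullback = λ f g → let (_ , p , q , P) = vecPullback f g in
        record { p₁ = p ; p₂ = q ; isPullback = toPullback P }
    ; ⊕-pullback = λ P P′ → toPullback (⊕-vecPullback (fromPullback P) (fromPullback P′))
    }

  hasPushouts : HasPullbacks (Mat ᵒᵖ)
  hasPushouts = record
    { pullback = λ f g →
        let P = HasPullbacks.pullback hasPullbacks (transpose f) (transpose g) in
        record { p₁ = transpose (Pullback.p₁ P) ; p₂ = transpose (Pullback.p₂ P)
               ; isPullback = toPushout (Pullback.isPullback P) }
    ; ⊕-pullback = λ {f = f} {g} {p} {q} {f′} {g′} {p′} {q′} P P′ →
        isPullback-resp (Mat ᵒᵖ)
          (⊕-transpose (transpose f) (transpose f′)) (⊕-transpose (transpose g) (transpose g′))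
          (⊕-transpose (transpose p) (transpose p′)) (⊕-transpose (transpose q) (transpose q′))
          (toPushout (HasPullbacks.⊕-pullback hasPullbacks (fromPushout P) (fromPushout P′)))
    }

module Subspaces (K : CommutativeRing c ℓ) where
  open CommutativeRing K using (Carrier; setoid) renaming (_+_ to _⊞_; _*_ to _⊠_)
  open Matrices K

  record Subspace (m n : ℕ) : Set (lsuc (c ⊔ ℓ)) where
    field
      rel   : REL (V m) (V n) (c ⊔ ℓ)
      resp  : ∀ {x x′ y y′} → x ≋ x′ → y ≋ y′ → rel x y → rel x′ y′
      has-0 : rel 𝟎 𝟎
      add   : ∀ {x x′ y y′} → rel x y → rel x′ y′ →
              rel (λ i → x i ⊞ x′ i) (λ i → y i ⊞ y′ i)
      scale : ∀ r {x y} → rel x y → rel (λ i → r ⊠ x i) (λ i → r ⊠ y i)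

  open Subspace public using (rel)

  infix 4 _≈ˢ_
  record _≈ˢ_ {m n} (R S : Subspace m n) : Set (c ⊔ ℓ) where
    constructor mk≈ˢ
    field
      equivalent : ∀ x y → rel R x y ⇔ rel S x y

  open _≈ˢ_ public

  ⟨_⟩ : ∀ {m n} → Matrix m n → Subspace m n
  ⟨ A ⟩ = record
    { rel = λ x y → Lift c (A · x ≋ y)
    ; resp = λ { p q (lift r) → lift (≋-trans (·-congˡ A (≋-sym p)) (≋-trans r q)) }
    ; has-0 = lift (λ i → ⊙-𝟎ʳ (A i))
    ; add = λ { (lift p) (lift q) → lift (λ i → trans (⊙-+ʳ (A i) _ _) (+-cong (p i) (q i))) }
    ; scale = λ { r (lift p) → lift (λ i → trans (⊙-*ʳ r (A i) _) (*-congˡ (p i))) }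
    }
    where open CommutativeRing K using (trans; +-cong; *-congˡ)

  idˢ : ∀ {n} → Subspace n n
  idˢ = record
    { rel = λ x y → Lift c (x ≋ y)
    ; resp = λ { p q (lift r) → lift (≋-trans (≋-sym p) (≋-trans r q)) }
    ; has-0 = lift ≋-refl
    ; add = λ { (lift p) (lift q) → lift (λ i → +-cong (p i) (q i)) }
    ; scale = λ { r (lift p) → lift (λ i → *-congˡ (p i)) }
    }
    where open CommutativeRing K using (+-cong; *-congˡ)

  infixr 7 _⨾ˢ_
  _⨾ˢ_ : ∀ {m n p} → Subspace m n → Subspace n p → Subspace m p
  R ⨾ˢ S = record
    { rel = λ x z → ∃ λ y → rel R x y × rel S y z
    ; resp = λ { p q (y , r , s) → y , R.resp p ≋-refl r , S.resp ≋-refl q s }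
    ; has-0 = 𝟎 , R.has-0 , S.has-0
    ; add = λ { (_ , r , s) (_ , r′ , s′) → _ , R.add r r′ , S.add s s′ }
    ; scale = λ { k (_ , r , s) → _ , R.scale k r , S.scale k s }
    }
    where
    module R = Subspace R
    module S = Subspace S

  infixr 8 _⊕ˢ_
  _⊕ˢ_ : ∀ {m n p q} → Subspace m n → Subspace p q → Subspace (m + p) (n + q)
  _⊕ˢ_ {m} {n} {p} {q} R S = record
    { rel = λ x y → rel R (take m x) (take n y) × rel S (drop m x) (drop n y)
    ; resp = λ { e f (r , s) → R.resp (λ i → e (i ↑ˡ p)) (λ i → f (i ↑ˡ q)) r ,
                               S.resp (λ i → e (m ↑ʳ i)) (λ i → f (n ↑ʳ i)) s }
    ; has-0 = R.has-0 , S.has-0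
    ; add = λ { (r , s) (r′ , s′) → R.add r r′ , S.add s s′ }
    ; scale = λ { k (r , s) → R.scale k r , S.scale k s }
    }
    where
    module R = Subspace R
    module S = Subspace S

  σˢ : ∀ m n → Subspace (m + n) (n + m)
  σˢ m n = record
    { rel = λ u v → Lift c (take m u ≋ drop n v × drop m u ≋ take n v)
    ; resp = λ { e f (lift (p , q)) → lift
        ((λ i → trans (sym (e (i ↑ˡ n))) (trans (p i) (f (n ↑ʳ i)))) ,
         (λ i → trans (sym (e (m ↑ʳ i))) (trans (q i) (f (i ↑ˡ m))))) }
    ; has-0 = lift (≋-refl , ≋-refl)
    ; add = λ { (lift (p , q)) (lift (p′ , q′)) → lift
        ((λ i → +-cong (p i) (p′ i)) , (λ i → +-cong (q i) (q′ i))) }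
    ; scale = λ { r (lift (p , q)) → lift ((λ i → *-congˡ (p i)) , (λ i → *-congˡ (q i))) }
    }
    where open CommutativeRing K using (trans; sym; +-cong; *-congˡ)

  ≈ˢ-refl : ∀ {m n} {R : Subspace m n} → R ≈ˢ R
  ≈ˢ-refl = mk≈ˢ λ _ _ → ⇔.refl

  ≈ˢ-sym : ∀ {m n} {R S : Subspace m n} → R ≈ˢ S → S ≈ˢ R
  ≈ˢ-sym (mk≈ˢ p) = mk≈ˢ λ x y → ⇔.sym (p x y)

  ≈ˢ-trans : ∀ {m n} {R S T : Subspace m n} → R ≈ˢ S → S ≈ˢ T → R ≈ˢ T
  ≈ˢ-trans (mk≈ˢ p) (mk≈ˢ q) = mk≈ˢ λ x y → ⇔.trans (p x y) (q x y)

  ⨾ˢ-cong : ∀ {m n p} {R R′ : Subspace m n} {S S′ : Subspace n p} →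
            R ≈ˢ R′ → S ≈ˢ S′ → R ⨾ˢ S ≈ˢ R′ ⨾ˢ S′
  ⨾ˢ-cong (mk≈ˢ p) (mk≈ˢ q) = mk≈ˢ λ x z → mk⇔
    (λ { (y , r , s) → y , Equivalence.to (p x y) r , Equivalence.to (q y z) s })
    (λ { (y , r , s) → y , Equivalence.from (p x y) r , Equivalence.from (q y z) s })

  ⊕ˢ-cong : ∀ {m n p q} {R R′ : Subspace m n} {S S′ : Subspace p q} →
            R ≈ˢ R′ → S ≈ˢ S′ → R ⊕ˢ S ≈ˢ R′ ⊕ˢ S′
  ⊕ˢ-cong (mk≈ˢ p) (mk≈ˢ q) = mk≈ˢ λ x y → mk⇔
    (λ { (r , s) → Equivalence.to (p _ _) r , Equivalence.to (q _ _) s })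
    (λ { (r , s) → Equivalence.from (p _ _) r , Equivalence.from (q _ _) s })

  ⟨⟩-I : ∀ {n} → ⟨ I {n} ⟩ ≈ˢ idˢ
  ⟨⟩-I = mk≈ˢ λ x y → mk⇔ (λ { (lift p) → lift (≋-trans (≋-sym (·-I x)) p) })
                 (λ { (lift p) → lift (≋-trans (·-I x) p) })

  ⟨⟩-⨾ : ∀ {m n p} (A : Matrix m n) (B : Matrix n p) → ⟨ A ⨾ᴹ B ⟩ ≈ˢ ⟨ A ⟩ ⨾ˢ ⟨ B ⟩
  ⟨⟩-⨾ A B = mk≈ˢ λ x z → mk⇔
    (λ { (lift p) → A · x , lift ≋-refl , lift (≋-trans (≋-sym (·-⨾ A B x)) p) })
    (λ { (y , lift p , lift q) → lift (≋-trans (·-⨾ A B x) (≋-trans (·-congˡ B p) q)) })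

  ⟨⟩-⊕ : ∀ {m n p q} (A : Matrix m n) (B : Matrix p q) → ⟨ A ⊕ᴹ B ⟩ ≈ˢ ⟨ A ⟩ ⊕ˢ ⟨ B ⟩
  ⟨⟩-⊕ {m} {n} A B = mk≈ˢ λ x y → mk⇔
    (λ { (lift e) → lift (≋-trans (≋-sym (⊕-take A B x)) (λ i → e (i ↑ˡ _))) ,
                    lift (≋-trans (≋-sym (⊕-drop A B x)) (λ i → e (n ↑ʳ i))) })
    (λ { (lift e , lift f) → lift (split-ext {n} (≋-trans (⊕-take A B x) e)
                                                 (≋-trans (⊕-drop A B x) f)) })

  σ-split : ∀ {m n} (x : V (m + n)) → σᴹ m n · x ≋ drop m x ++ take m x
  σ-split {m} {n} x = ≋-trans (·-congˡ (σᴹ m n) (++-η m x)) (·-σ (take m x) (drop m x))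

  ⟨⟩-σ : ∀ m n → ⟨ σᴹ m n ⟩ ≈ˢ σˢ m n
  ⟨⟩-σ m n = mk≈ˢ λ x y → mk⇔
    (λ { (lift e) → let e′ = ≋-trans (≋-sym (σ-split {m} x)) e in lift
           (≋-trans (≋-sym (drop-++ (drop m x) (take m x))) (λ i → e′ (n ↑ʳ i)) ,
            ≋-trans (≋-sym (take-++ (drop m x) (take m x))) (λ i → e′ (i ↑ˡ m))) })
    (λ { (lift (p , q)) → lift (≋-trans (σ-split {m} x)
           (split-ext {n} (≋-trans (take-++ (drop m x) (take m x)) q)
                          (≋-trans (drop-++ (drop m x) (take m x)) p))) })

  ⟨⟩-cong : ∀ {m n} {A B : Matrix m n} → A ≈ᴹ B → ⟨ A ⟩ ≈ˢ ⟨ B ⟩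
  ⟨⟩-cong p = mk≈ˢ λ x y → mk⇔ (λ { (lift e) → lift (≋-trans (≋-sym (·-congʳ p)) e) })
                      (λ { (lift e) → lift (≋-trans (·-congʳ p) e) })

  castˢ : ∀ {m n} → m ≡ n → Subspace m n
  castˢ {m} p = ≡.subst (Subspace m) p idˢ

  ⟨⟩-cast : ∀ {m n} (p : m ≡ n) → ⟨ castᴹ p ⟩ ≈ˢ castˢ p
  ⟨⟩-cast ≡.refl = ⟨⟩-I

  cast-inverse : ∀ {m n} (p : m ≡ n) (x : V n) → castᴹ p · (castᴹ (≡.sym p) · x) ≋ x
  cast-inverse ≡.refl x = ≋-trans (·-I _) (·-I x)

  -- R and S agree up to casts as soon as they agree on cast vectors
  cast-square : ∀ {m n p q} {R : Subspace m n} {S : Subspace p q} (r : m ≡ p) (s : n ≡ q) →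
                (∀ x y → rel R x y ⇔ rel S (castᴹ r · x) (castᴹ s · y)) →
                R ⨾ˢ castˢ s ≈ˢ castˢ r ⨾ˢ S
  cast-square {R = R} {S} r s eq =
    ≈ˢ-trans (⨾ˢ-cong (≈ˢ-refl {R = R}) (≈ˢ-sym (⟨⟩-cast s)))
      (≈ˢ-trans (mk≈ˢ λ x z → mk⇔
        (λ { (y , p , lift e) → castᴹ r · x , lift ≋-refl ,
               Subspace.resp S ≋-refl e (Equivalence.to (eq x y) p) })
        (λ { (w , lift e , p) → castᴹ (≡.sym s) · z ,
               Equivalence.from (eq x _)
                 (Subspace.resp S (≋-sym e) (≋-sym (cast-inverse s z)) p) ,
               lift (cast-inverse s z) }))
      (⨾ˢ-cong (⟨⟩-cast r) (≈ˢ-refl {R = S})))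

  cast-assoc : ∀ m n p (x : V (m + n + p)) → castᴹ (+-assoc m n p) · x
               ≋ take m (take (m + n) x) ++ (drop m (take (m + n) x) ++ drop (m + n) x)
  cast-assoc m n p x = ≋-trans
    (·-congˡ (castᴹ (+-assoc m n p)) (≋-trans (++-η (m + n) x) (++-cong (++-η m (take (m + n) x)) ≋-refl)))
    (⊕-cast {m} {n} p (take m (take (m + n) x)) _ _)

  cast-identity : ∀ m (x : V (m + 0)) → castᴹ (+-identityʳ m) · x ≋ take m x
  cast-identity m x = ≋-trans (·-congˡ (castᴹ (+-identityʳ m)) (++-η m x)) (0-cast (take m x) (drop m x))

  assoc-square : ∀ {m n p m′ n′ p′} {R : Subspace m m′} {S : Subspace n n′}
                 {T : Subspace p p′} (x : V (m + n + p)) (y : V (m′ + n′ + p′)) →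
                 rel ((R ⊕ˢ S) ⊕ˢ T) x y ⇔
                 rel (R ⊕ˢ (S ⊕ˢ T)) (castᴹ (+-assoc m n p) · x) (castᴹ (+-assoc m′ n′ p′) · y)
  assoc-square {m} {n} {p} {m′} {n′} {p′} {R} {S} {T} x y = mk⇔
    (λ { ((r , s) , t) → R.resp (≋-sym (c₁ m n p x)) (≋-sym (c₁ m′ n′ p′ y)) r ,
                         S.resp (≋-sym (c₂ m n p x)) (≋-sym (c₂ m′ n′ p′ y)) s ,
                         T.resp (≋-sym (c₃ m n p x)) (≋-sym (c₃ m′ n′ p′ y)) t })
    (λ { (r , s , t) → (R.resp (c₁ m n p x) (c₁ m′ n′ p′ y) r ,
                        S.resp (c₂ m n p x) (c₂ m′ n′ p′ y) s) ,
                       T.resp (c₃ m n p x) (c₃ m′ n′ p′ y) t })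
    where
    module R = Subspace R
    module S = Subspace S
    module T = Subspace T
    c₁ : ∀ m n p (x : V (m + n + p)) →
         take m (castᴹ (+-assoc m n p) · x) ≋ take m (take (m + n) x)
    c₁ m n p x = ≋-trans (λ i → cast-assoc m n p x (i ↑ˡ _)) (take-++ (take m (take (m + n) x)) _)
    c₂ : ∀ m n p (x : V (m + n + p)) →
         take n (drop m (castᴹ (+-assoc m n p) · x)) ≋ drop m (take (m + n) x)
    c₂ m n p x = ≋-trans (λ i → cast-assoc m n p x (m ↑ʳ (i ↑ˡ p)))
      (≋-trans (λ i → drop-++ (take m (take (m + n) x)) _ (i ↑ˡ p)) (take-++ (drop m (take (m + n) x)) _))
    c₃ : ∀ m n p (x : V (m + n + p)) →
         drop n (drop m (castᴹ (+-assoc m n p) · x)) ≋ drop (m + n) x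
    c₃ m n p x = ≋-trans (λ i → cast-assoc m n p x (m ↑ʳ (n ↑ʳ i)))
      (≋-trans (λ i → drop-++ (take m (take (m + n) x)) _ (n ↑ʳ i)) (drop-++ (drop m (take (m + n) x)) _))

  SV : PROP (lsuc (c ⊔ ℓ)) (c ⊔ ℓ)
  SV = record
    { Hom = Subspace
    ; _≈_ = _≈ˢ_
    ; id = idˢ
    ; _⨾_ = _⨾ˢ_
    ; _⊕_ = _⊕ˢ_
    ; σ = σˢ
    ; isEquivalence = record
        { refl = ≈ˢ-refl ; sym = ≈ˢ-sym ; trans = ≈ˢ-trans }
    ; ⨾-cong = ⨾ˢ-cong
    ; idˡ = λ {f = R} → mk≈ˢ λ x z → mk⇔
        (λ { (y , lift e , r) → Subspace.resp R (≋-sym e) ≋-refl r })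
        (λ r → x , lift ≋-refl , r)
    ; idʳ = λ {f = R} → mk≈ˢ λ x z → mk⇔
        (λ { (y , r , lift e) → Subspace.resp R ≋-refl e r })
        (λ r → z , r , lift ≋-refl)
    ; assoc = mk≈ˢ λ x z → mk⇔
        (λ { (_ , (_ , r , s) , t) → _ , r , _ , s , t })
        (λ { (_ , r , _ , s , t) → _ , (_ , r , s) , t })
    ; ⊕-cong = ⊕ˢ-cong
    ; ⊕-id = λ {m} {n} → mk≈ˢ λ x y → mk⇔
        (λ { (lift p , lift q) → lift (split-ext {m} p q) })
        (λ { (lift e) → lift (λ i → e (i ↑ˡ n)) , lift (λ i → e (m ↑ʳ i)) })
    ; ⊕-⨾ = λ {m} {n} {p} {m′} {n′} {p′} {R} {S} {R′} {S′} → mk≈ˢ λ x z → mk⇔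
        (λ { ((y , r , s) , (y′ , r′ , s′)) → y ++ y′ ,
             (Subspace.resp R ≋-refl (≋-sym (take-++ y y′)) r ,
              Subspace.resp R′ ≋-refl (≋-sym (drop-++ y y′)) r′) ,
             (Subspace.resp S (≋-sym (take-++ y y′)) ≋-refl s ,
              Subspace.resp S′ (≋-sym (drop-++ y y′)) ≋-refl s′) })
        (λ { (y , (r , r′) , (s , s′)) → (take n y , r , s) , (drop n y , r′ , s′) })
    ; ⊕-identityˡ = mk≈ˢ λ x y → mk⇔ proj₂ (λ r → lift (λ ()) , r)
    ; ⊕-identityʳ = λ {m} {n} {R} → cast-square {R = R ⊕ˢ idˢ {0}} {R}
        (+-identityʳ m) (+-identityʳ n) λ x y → mk⇔
          (λ { (r , _) → Subspace.resp R (≋-sym (cast-identity m x)) (≋-sym (cast-identity n y)) r })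
          (λ r → Subspace.resp R (cast-identity m x) (cast-identity n y) r , lift (λ ()))
    ; ⊕-assoc = λ {m} {n} {p} {m′} {n′} {p′} {R} {S} {T} →
        cast-square {R = (R ⊕ˢ S) ⊕ˢ T} {R ⊕ˢ (S ⊕ˢ T)} (+-assoc m n p) (+-assoc m′ n′ p′)
          (assoc-square {R = R} {S} {T})
    ; σ-natural = λ {m} {n} {m′} {n′} {R} {S} → mk≈ˢ λ x z → mk⇔
        (λ { (y , (r , s) , lift (p , q)) → drop m x ++ take m x ,
             lift (≋-sym (drop-++ (drop m x) (take m x)) , ≋-sym (take-++ (drop m x) (take m x))) ,
             Subspace.resp S (≋-sym (take-++ (drop m x) (take m x))) q s ,
             Subspace.resp R (≋-sym (drop-++ (drop m x) (take m x))) p r })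
        (λ { (y , lift (p , q) , (s , r)) → drop n′ z ++ take n′ z ,
             (Subspace.resp R (≋-sym p) (≋-sym (take-++ (drop n′ z) (take n′ z))) r ,
              Subspace.resp S (≋-sym q) (≋-sym (drop-++ (drop n′ z) (take n′ z))) s) ,
             lift (take-++ (drop n′ z) (take n′ z) , drop-++ (drop n′ z) (take n′ z)) })
    ; σ-involutive = λ {m} {n} → mk≈ˢ λ x z → mk⇔
        (λ { (y , lift (p , q) , lift (p′ , q′)) →
             lift (split-ext {m} (≋-trans p q′) (≋-trans q p′)) })
        (λ { (lift e) → drop m x ++ take m x ,
             lift (≋-sym (drop-++ (drop m x) (take m x)) , ≋-sym (take-++ (drop m x) (take m x))) ,
             lift (≋-trans (take-++ (drop m x) (take m x)) (λ i → e (m ↑ʳ i)) ,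
                   ≋-trans (drop-++ (drop m x) (take m x)) (λ i → e (i ↑ˡ n))) })
    ; σ-hexagon = λ {m} {n} {p} →
        let c₁ = castᴹ (+-assoc m n p)
            c₂ = castᴹ (+-assoc n p m)
            c₃ = castᴹ (+-assoc n m p)
        in ≈ˢ-trans
          (≈ˢ-sym (≈ˢ-trans (⟨⟩-⨾ c₁ (σᴹ m (n + p) ⨾ᴹ c₂))
            (⨾ˢ-cong (⟨⟩-cast (+-assoc m n p)) (≈ˢ-trans (⟨⟩-⨾ (σᴹ m (n + p)) c₂)
              (⨾ˢ-cong (⟨⟩-σ m (n + p)) (⟨⟩-cast (+-assoc n p m)))))))
          (≈ˢ-trans (⟨⟩-cong (PROP.σ-hexagon Mat {m} {n} {p}))
            (≈ˢ-trans (⟨⟩-⨾ (σᴹ m n ⊕ᴹ I {p}) (c₃ ⨾ᴹ (I {n} ⊕ᴹ σᴹ m p)))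
              (⨾ˢ-cong (≈ˢ-trans (⟨⟩-⊕ (σᴹ m n) I) (⊕ˢ-cong (⟨⟩-σ m n) ⟨⟩-I))
                (≈ˢ-trans (⟨⟩-⨾ c₃ (I {n} ⊕ᴹ σᴹ m p)) (⨾ˢ-cong (⟨⟩-cast (+-assoc n m p))
                  (≈ˢ-trans (⟨⟩-⊕ I (σᴹ m p)) (⊕ˢ-cong ⟨⟩-I (⟨⟩-σ m p))))))))
    }

-- A vector outside a subspace is separated from it by a linear functional.

module Separation {K : CommutativeRing c ℓ} (isField : IsField K)
                  (dec : (P : Set (c ⊔ ℓ)) → Dec P) where
  open CommutativeRing K hiding (zero)
    renaming (_+_ to _⊞_; +-assoc to ⊞-assoc; +-identityʳ to ⊞-identityʳ)
  open RingProperties ring using (-‿distribˡ-*; -‿distribʳ-*)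
  open IsField isField
  open Matrices K

  separate : ∀ {n} (W : Pred (V n) (c ⊔ ℓ)) → IsSubmodule W → (v : V n) →
             W v ⊎ ∃ λ φ → (∀ w → W w → φ ⊙ w ≈ 0#) × φ ⊙ v ≉ 0#
  separate {zero} W isSub v = inj₁ (resp (λ ()) has-0)
    where open IsSubmodule isSub
  separate {suc n} W isSub v
    with dec (∃ λ w → W w × w zero ≉ 0#)
    where open IsSubmodule isSub
  ... | yes (w , w∈W , w₀≉0) = pivot (separate W′ (tail-submodule isSub) (reduce v))
    where
    open IsSubmodule isSub

    w₀⁻¹ : Carrier
    w₀⁻¹ = proj₁ (inverse w₀≉0)

    t : V (suc n)
    t i = w₀⁻¹ * w i

    t₀≈1 : t zero ≈ 1#
    t₀≈1 = proj₂ (inverse w₀≉0)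

    W′ : Pred (V n) (c ⊔ ℓ)
    W′ x = W (0# ∷ x)

    -- the component of x in the hyperplane x₀ = 0, along t
    reduce : V (suc n) → V n
    reduce x i = x (suc i) ⊞ (- x zero) * t (suc i)

    cancel : ∀ a b → a * b ⊞ (- a) * b ≈ 0#
    cancel a b = trans (sym (distribʳ b a (- a))) (trans (*-congʳ (-‿inverseʳ a)) (zeroˡ b))

    reduce∈W : ∀ {x} → W x → W′ (reduce x)
    reduce∈W {x} x∈W = resp
      (∷-ext (trans (+-congʳ (sym (trans (*-congˡ t₀≈1) (*-identityʳ _))))
                    (cancel (x zero) (t zero)))
             (λ _ → refl))
      (add x∈W (scale (- x zero) (scale w₀⁻¹ w∈W)))

    unreduce∈W : W′ (reduce v) → W v
    unreduce∈W m = resp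
      (∷-ext (trans (+-identityˡ _) (trans (*-congˡ t₀≈1) (*-identityʳ _)))
             (λ i → trans (⊞-assoc _ _ _) (trans (+-congˡ (trans (+-comm _ _)
                      (cancel (v zero) (t (suc i))))) (⊞-identityʳ _))))
      (add m (scale (v zero) (scale w₀⁻¹ w∈W)))

    module _ (φ : V n) where
      ψ : V (suc n)
      ψ = (- (φ ⊙ tail t)) ∷ φ

      ψ-reduce : ∀ x → ψ ⊙ x ≈ φ ⊙ reduce x
      ψ-reduce x = begin
        (- (φ ⊙ tail t)) * x zero ⊞ (φ ⊙ tail x)
          ≈⟨ +-comm _ _ ⟩
        (φ ⊙ tail x) ⊞ (- (φ ⊙ tail t)) * x zero
          ≈⟨ +-congˡ (trans (*-comm _ _) (trans (sym (-‿distribʳ-* _ _)) (-‿distribˡ-* _ _))) ⟩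
        (φ ⊙ tail x) ⊞ (- x zero) * (φ ⊙ tail t)
          ≈⟨ +-congˡ (⊙-*ʳ (- x zero) φ (tail t)) ⟨
        (φ ⊙ tail x) ⊞ (φ ⊙ (λ i → (- x zero) * t (suc i)))
          ≈⟨ ⊙-+ʳ φ (tail x) _ ⟨
        φ ⊙ reduce x ∎
        where open SetoidReasoning setoid

    pivot : W′ (reduce v) ⊎ (∃ λ φ → (∀ w → W′ w → φ ⊙ w ≈ 0#) × φ ⊙ reduce v ≉ 0#) →
            W v ⊎ ∃ λ φ → (∀ w → W w → φ ⊙ w ≈ 0#) × φ ⊙ v ≉ 0#
    pivot (inj₁ m) = inj₁ (unreduce∈W m)
    pivot (inj₂ (φ , kills , φv≉0)) = inj₂ (ψ φ ,
      (λ x x∈W → trans (ψ-reduce φ x) (kills (reduce x) (reduce∈W x∈W))) ,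
      λ eq → φv≉0 (trans (sym (ψ-reduce φ v)) eq))
  ... | no flat = hyperplane (dec (Lift c (v zero ≈ 0#)))
    where
    open IsSubmodule isSub

    W′ : Pred (V n) (c ⊔ ℓ)
    W′ x = W (0# ∷ x)

    head≈0 : ∀ {w} → W w → w zero ≈ 0#
    head≈0 {w} w∈W with dec (Lift c (w zero ≈ 0#))
    ... | yes (lift p) = p
    ... | no ¬p        = contradiction (w , w∈W , λ p → ¬p (lift p)) flat

    e₀-⊙ : ∀ x → (1# ∷ 𝟎) ⊙ x ≈ x zero
    e₀-⊙ x = trans (+-cong (*-identityˡ _) (⊙-𝟎ˡ (tail x))) (⊞-identityʳ _)

    0∷-⊙ : ∀ (φ : V n) x → (0# ∷ φ) ⊙ x ≈ φ ⊙ tail x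
    0∷-⊙ φ x = trans (+-congʳ (zeroˡ _)) (+-identityˡ _)

    hyperplane : Dec (Lift c (v zero ≈ 0#)) →
                 W v ⊎ ∃ λ φ → (∀ w → W w → φ ⊙ w ≈ 0#) × φ ⊙ v ≉ 0#
    hyperplane (no v₀≉0) = inj₂ (1# ∷ 𝟎 , (λ w w∈W → trans (e₀-⊙ w) (head≈0 w∈W)) ,
      λ eq → v₀≉0 (lift (trans (sym (e₀-⊙ v)) eq)))
    hyperplane (yes (lift v₀≈0)) with separate W′ (tail-submodule isSub) (tail v)
    ... | inj₁ m = inj₁ (resp (∷-ext (sym v₀≈0) (λ _ → refl)) m)
    ... | inj₂ (φ , kills , φv≉0) = inj₂ (0# ∷ φ ,
      (λ w w∈W → trans (0∷-⊙ φ w) (kills (tail w)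
        (resp (∷-ext (head≈0 w∈W) (λ _ → refl)) w∈W))) ,
      λ eq → φv≉0 (trans (sym (0∷-⊙ φ v)) eq))

-- k has the levels of the usual construction of a field of fractions, by pairs
-- (a , b) with a proof of b ≉ 0.

module Square
  {R : CommutativeRing c ℓ} {k : CommutativeRing (c ⊔ ℓ) ℓ}
  (⟦_⟧ : CommutativeRing.Carrier R → CommutativeRing.Carrier k)
  (isPID : IsPID R) (isFrac : IsFieldOfFractions R k ⟦_⟧) where

  open PID isPID
  open IsFieldOfFractions isFrac
  open IsField isField
  open IsRingMonomorphism isMonomorphism
  open Separation isField dec
  private
    module R = CommutativeRing R
    module k = CommutativeRing k
    module MR = Matrices R
    module Mk = Matrices k
    open Matrices R using (Matrix; Mat)
    open Mk hiding (Matrix; Mat)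
  open Subspaces k

  ⟦_⟧ᵛ : ∀ {n} → MR.V n → Mk.V n
  ⟦ x ⟧ᵛ i = ⟦ x i ⟧

  ⟦_⟧ᴹ : ∀ {m n} → Matrix m n → Mk.Matrix m n
  ⟦ A ⟧ᴹ i j = ⟦ A i j ⟧

  ⟦⟧-⊙ : ∀ {n} (x y : MR.V n) → ⟦ x MR.⊙ y ⟧ k.≈ ⟦ x ⟧ᵛ ⊙ ⟦ y ⟧ᵛ
  ⟦⟧-⊙ {zero}  x y = 0#-homo
  ⟦⟧-⊙ {suc n} x y = k.trans (+-homo _ _) (k.+-cong (*-homo _ _) (⟦⟧-⊙ (tail x) (tail y)))

  ⟦⟧-· : ∀ {m n} (A : Matrix m n) (x : MR.V m) → ⟦ A MR.· x ⟧ᵛ ≋ ⟦ A ⟧ᴹ · ⟦ x ⟧ᵛ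
  ⟦⟧-· A x i = ⟦⟧-⊙ (A i) x

  ⟦⟧-I : ∀ {n} (i j : Fin n) → ⟦ MR.I i j ⟧ k.≈ I i j
  ⟦⟧-I zero    zero    = 1#-homo
  ⟦⟧-I zero    (suc j) = 0#-homo
  ⟦⟧-I (suc i) zero    = 0#-homo
  ⟦⟧-I (suc i) (suc j) = ⟦⟧-I i j

  ⟦⟧-++ : ∀ {m n} (x : MR.V m) (y : MR.V n) {x′ y′} → ⟦ x ⟧ᵛ ≋ x′ → ⟦ y ⟧ᵛ ≋ y′ →
          ⟦ x ++ y ⟧ᵛ ≋ x′ ++ y′
  ⟦⟧-++ {m} x y p q i with splitAt m i
  ... | inj₁ j = p j
  ... | inj₂ j = q j

  ⟦⟧-⊕ : ∀ {m n p q} (A : Matrix m n) (B : Matrix p q) →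
         ⟦ A MR.⊕ᴹ B ⟧ᴹ ≈ᴹ ⟦ A ⟧ᴹ ⊕ᴹ ⟦ B ⟧ᴹ
  ⟦⟧-⊕ {n = n} A B i with splitAt n i
  ... | inj₁ j = ⟦⟧-++ (A j) MR.𝟎 ≋-refl (λ _ → 0#-homo)
  ... | inj₂ j = ⟦⟧-++ MR.𝟎 (B j) (λ _ → 0#-homo) ≋-refl

  ⟦⟧-σ : ∀ m n → ⟦ MR.σᴹ m n ⟧ᴹ ≈ᴹ σᴹ m n
  ⟦⟧-σ m n i with splitAt n i
  ... | inj₁ j = ⟦⟧-++ (MR.𝟎 {m}) (MR.I j) (λ _ → 0#-homo) (⟦⟧-I j)
  ... | inj₂ j = ⟦⟧-++ (MR.I j) (MR.𝟎 {n}) (⟦⟧-I j) (λ _ → 0#-homo)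

  scalars : Mat ⇒ Mk.Mat
  scalars = record
    { map = ⟦_⟧ᴹ
    ; cong = λ p i j → ⟦⟧-cong (p i j)
    ; map-id = ⟦⟧-I
    ; map-⨾ = λ {f = A} {B} i j → ⟦⟧-⊙ (B i) (λ t → A t j)
    ; map-⊕ = λ {f = A} {B} → ⟦⟧-⊕ A B
    ; map-σ = λ {m} {n} → ⟦⟧-σ m n
    }

  module SpanMat   = Spans Mat hasPullbacks
  module CospanMat = Spans (Mat ᵒᵖ) hasPushouts

  Span-Mat Cospan-Mat : PROP c (c ⊔ ℓ)
  Span-Mat   = SpanMat.Span
  Cospan-Mat = CospanMat.Span

  ·-⟦⨾⟧ : ∀ {m n p} (A : Matrix m n) (B : Matrix n p) (x : Mk.V m) →
          ⟦ A MR.⨾ᴹ B ⟧ᴹ · x ≋ ⟦ B ⟧ᴹ · (⟦ A ⟧ᴹ · x)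
  ·-⟦⨾⟧ A B x = ≋-trans (·-congʳ (_⇒_.map-⨾ scalars {f = A} {B})) (·-⨾ ⟦ A ⟧ᴹ ⟦ B ⟧ᴹ x)

  ·-⟦I⟧ : ∀ {n} (x : Mk.V n) → ⟦ MR.I ⟧ᴹ · x ≋ x
  ·-⟦I⟧ x = ≋-trans (·-congʳ ⟦⟧-I) (·-I x)

  ·-⟦⊕⟧ : ∀ {m n p q} (A : Matrix m n) (B : Matrix p q) (x : Mk.V (m + p)) →
          ⟦ A MR.⊕ᴹ B ⟧ᴹ · x ≋ (⟦ A ⟧ᴹ · take m x) ++ (⟦ B ⟧ᴹ · drop m x)
  ·-⟦⊕⟧ {m} A B x = ≋-trans (·-cong (⟦⟧-⊕ A B) (++-η m x)) (·-⊕ ⟦ A ⟧ᴹ ⟦ B ⟧ᴹ _ _)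

  ·-⟦σ⟧ : ∀ m n (x : Mk.V (m + n)) → ⟦ MR.σᴹ m n ⟧ᴹ · x ≋ drop m x ++ take m x
  ·-⟦σ⟧ m n x = ≋-trans (·-cong (⟦⟧-σ m n) (++-η m x)) (·-σ (take m x) (drop m x))

  ⟦d⟧≉0 : ∀ {d} → d R.≉ R.0# → ⟦ d ⟧ k.≉ k.0#
  ⟦d⟧≉0 d≉0 eq = d≉0 (injective (k.trans eq (k.sym 0#-homo)))

  -- every vector over k has a common denominator in R
  clear : ∀ {n} (x : Mk.V n) → ∃₂ λ d (y : MR.V n) → d R.≉ R.0# × (λ i → ⟦ d ⟧ k.* x i) ≋ ⟦ y ⟧ᵛ
  clear {zero}  x = R.1# , (λ ()) , IsPID.1≉0 isPID , λ ()
  clear {suc n} x with fraction (x zero) | clear (tail x)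
  ... | a , b , b≉0 , eq | d , y , d≉0 , eqs = d R.* b , (d R.* a) ∷ (λ i → b R.* y i) , db≉0 , prf
    where
    db≉0 : d R.* b R.≉ R.0#
    db≉0 p with IsPID.noZeroDivisors isPID p
    ... | inj₁ q = d≉0 q
    ... | inj₂ q = b≉0 q
    prf : (λ i → ⟦ d R.* b ⟧ k.* x i) ≋ ⟦ (d R.* a) ∷ (λ i → b R.* y i) ⟧ᵛ
    prf zero = k.trans (k.*-congʳ (*-homo d b)) (k.trans (k.*-assoc _ _ _)
      (k.trans (k.*-congˡ (k.trans (k.*-comm _ _) eq)) (k.sym (*-homo d a))))
    prf (suc i) = k.trans (k.*-congʳ (k.trans (*-homo d b) (k.*-comm _ _))) (k.trans (k.*-assoc _ _ _)
      (k.trans (k.*-congˡ (eqs i)) (k.sym (*-homo b (y i)))))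

  spanRel : ∀ {m n} → SpanMat.SpanHom m n → Subspace m n
  spanRel (SpanMat.span A B) = record
    { rel = λ x y → ∃ λ z → ⟦ A ⟧ᴹ · z ≋ x × ⟦ B ⟧ᴹ · z ≋ y
    ; resp = λ { p q (z , r , s) → z , ≋-trans r p , ≋-trans s q }
    ; has-0 = 𝟎 , (λ i → ⊙-𝟎ʳ (⟦ A ⟧ᴹ i)) , (λ i → ⊙-𝟎ʳ (⟦ B ⟧ᴹ i))
    ; add = λ { (z , p , q) (z′ , p′ , q′) → (λ i → z i k.+ z′ i) ,
        (λ i → k.trans (⊙-+ʳ (⟦ A ⟧ᴹ i) z z′) (k.+-cong (p i) (p′ i))) ,
        (λ i → k.trans (⊙-+ʳ (⟦ B ⟧ᴹ i) z z′) (k.+-cong (q i) (q′ i))) }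
    ; scale = λ { r (z , p , q) → (λ i → r k.* z i) ,
        (λ i → k.trans (⊙-*ʳ r (⟦ A ⟧ᴹ i) z) (k.*-congˡ (p i))) ,
        (λ i → k.trans (⊙-*ʳ r (⟦ B ⟧ᴹ i) z) (k.*-congˡ (q i))) }
    }

  cospanRel : ∀ {m n} → CospanMat.SpanHom m n → Subspace m n
  cospanRel (CospanMat.span A B) = record
    { rel = λ x y → Lift (c ⊔ ℓ) (⟦ A ⟧ᴹ · x ≋ ⟦ B ⟧ᴹ · y)
    ; resp = λ { p q (lift r) → lift (≋-trans (·-congˡ ⟦ A ⟧ᴹ (≋-sym p)) (≋-trans r (·-congˡ ⟦ B ⟧ᴹ q))) }
    ; has-0 = lift (λ i → k.trans (⊙-𝟎ʳ (⟦ A ⟧ᴹ i)) (k.sym (⊙-𝟎ʳ (⟦ B ⟧ᴹ i))))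
    ; add = λ { (lift p) (lift q) → lift (λ i → k.trans (⊙-+ʳ (⟦ A ⟧ᴹ i) _ _)
        (k.trans (k.+-cong (p i) (q i)) (k.sym (⊙-+ʳ (⟦ B ⟧ᴹ i) _ _)))) }
    ; scale = λ { r (lift p) → lift (λ i → k.trans (⊙-*ʳ r (⟦ A ⟧ᴹ i) _)
        (k.trans (k.*-congˡ (p i)) (k.sym (⊙-*ʳ r (⟦ B ⟧ᴹ i) _)))) }
    }

  private
    module MatP = PROP Mat

    spanRel-⊆ : ∀ {m n} {S T : SpanMat.SpanHom m n} → S SpanMat.≅ T →
                ∀ {x y} → rel (spanRel S) x y → rel (spanRel T) x y
    spanRel-⊆ {S = S} {T} i {x} {y} (z , p , q) = ⟦ to ⟧ᴹ · z ,
      ≋-trans (≋-sym (·-⟦⨾⟧ to T.left z)) (≋-trans (·-congʳ (_⇒_.cong scalars to-left)) p) ,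
      ≋-trans (≋-sym (·-⟦⨾⟧ to T.right z)) (≋-trans (·-congʳ (_⇒_.cong scalars to-right)) q)
      where
      open SpanMat._≅_ i
      module T = SpanMat.SpanHom T

    spanRel-⨾ : ∀ {m n p} (S : SpanMat.SpanHom m n) (T : SpanMat.SpanHom n p) →
                spanRel (SpanMat.compose S T) ≈ˢ spanRel S ⨾ˢ spanRel T
    spanRel-⨾ S T = mk≈ˢ λ x y → mk⇔
      (λ { (t , p , q) → ⟦ S.right ⟧ᴹ · (⟦ P.p₁ ⟧ᴹ · t) ,
             (⟦ P.p₁ ⟧ᴹ · t , ≋-trans (≋-sym (·-⟦⨾⟧ P.p₁ S.left t)) p , ≋-refl) ,
             (⟦ P.p₂ ⟧ᴹ · t ,
              ≋-trans (≋-sym (·-⟦⨾⟧ P.p₂ T.left t))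
                (≋-trans (·-congʳ (_⇒_.cong scalars (MatP.sym P.commutes))) (·-⟦⨾⟧ P.p₁ S.right t)) ,
              ≋-trans (≋-sym (·-⟦⨾⟧ P.p₂ T.right t)) q) })
      (λ { (u , (z , Az , Bz) , (w , Cw , Dw)) →
             let (t , p , q) = lift-pair z w (≋-trans Bz (≋-sym Cw)) in
             t , ≋-trans (·-⟦⨾⟧ P.p₁ S.left t) (≋-trans (·-congˡ ⟦ S.left ⟧ᴹ p) Az) ,
                 ≋-trans (·-⟦⨾⟧ P.p₂ T.right t) (≋-trans (·-congˡ ⟦ T.right ⟧ᴹ q) Dw) })
      where
      module S = SpanMat.SpanHom S
      module T = SpanMat.SpanHom T
      module P = Pullback (HasPullbacks.pullback hasPullbacks S.right T.left)
      module VP = MR.IsVecPullback (MR.fromPullback P.isPullback)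

      -- the pullback over R is also a pullback over k
      lift-pair : ∀ z w → ⟦ S.right ⟧ᴹ · z ≋ ⟦ T.left ⟧ᴹ · w →
                  ∃ λ t → ⟦ P.p₁ ⟧ᴹ · t ≋ z × ⟦ P.p₂ ⟧ᴹ · t ≋ w
      lift-pair z w eq with clear (z ++ w)
      ... | d , zw′ , d≉0 , eqs = t , back P.p₁ z z′ (proj₁ (proj₂ med)) dz , back P.p₂ w w′ (proj₂ (proj₂ med)) dw
        where
        z′ = take S.apex zw′
        w′ = drop S.apex zw′
        d⁻¹ = proj₁ (inverse (⟦d⟧≉0 d≉0))

        dz : (λ i → ⟦ d ⟧ k.* z i) ≋ ⟦ z′ ⟧ᵛ
        dz i = k.trans (k.*-congˡ (k.sym (take-++ z w i))) (eqs (i ↑ˡ _))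

        dw : (λ i → ⟦ d ⟧ k.* w i) ≋ ⟦ w′ ⟧ᵛ
        dw i = k.trans (k.*-congˡ (k.sym (drop-++ z w i))) (eqs (S.apex ↑ʳ i))

        scaled : ∀ {a b} (A : Matrix a b) (x : Mk.V a) (x′ : MR.V a) →
                 (λ i → ⟦ d ⟧ k.* x i) ≋ ⟦ x′ ⟧ᵛ →
                 ⟦ A MR.· x′ ⟧ᵛ ≋ (λ i → ⟦ d ⟧ k.* (⟦ A ⟧ᴹ · x) i)
        scaled A x x′ dx i = k.trans (⟦⟧-· A x′ i) (k.trans (·-congˡ ⟦ A ⟧ᴹ (≋-sym dx) i)
                               (⊙-*ʳ ⟦ d ⟧ (⟦ A ⟧ᴹ i) x))

        med : ∃ λ t′ → P.p₁ MR.· t′ MR.≋ z′ × P.p₂ MR.· t′ MR.≋ w′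
        med = VP.mediate z′ w′ (λ i → injective (k.trans (scaled S.right z z′ dz i)
                (k.trans (k.*-congˡ (eq i)) (k.sym (scaled T.left w w′ dw i)))))

        t : Mk.V P.apex
        t i = d⁻¹ k.* ⟦ proj₁ med i ⟧

        back : ∀ {a} (A : Matrix P.apex a) (x : Mk.V a) (x′ : MR.V a) → A MR.· proj₁ med MR.≋ x′ →
               (λ i → ⟦ d ⟧ k.* x i) ≋ ⟦ x′ ⟧ᵛ → ⟦ A ⟧ᴹ · t ≋ x
        back A x x′ eq dx i = k.trans (⊙-*ʳ d⁻¹ (⟦ A ⟧ᴹ i) _) (k.trans
          (k.*-congˡ (k.trans (k.sym (⟦⟧-· A (proj₁ med) i)) (k.trans (⟦⟧-cong (eq i)) (k.sym (dx i)))))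
          (k.trans (k.sym (k.*-assoc _ _ _)) (k.trans (k.*-congʳ (proj₂ (inverse (⟦d⟧≉0 d≉0))))
            (k.*-identityˡ _))))

    cospanRel-⊆ : ∀ {m n} {S T : CospanMat.SpanHom m n} → S CospanMat.≅ T →
                  ∀ {x y} → rel (cospanRel T) x y → rel (cospanRel S) x y
    cospanRel-⊆ {S = S} {T} i {x} {y} (lift p) = lift
      (≋-trans (·-congʳ (_⇒_.cong scalars (MatP.sym to-left))) (≋-trans (·-⟦⨾⟧ T.left to x)
        (≋-trans (·-congˡ ⟦ to ⟧ᴹ p) (≋-sym (≋-trans (·-congʳ (_⇒_.cong scalars (MatP.sym to-right)))
          (·-⟦⨾⟧ T.right to y))))))
      where
      open CospanMat._≅_ i
      module T = CospanMat.SpanHom T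

    cospanRel-⨾ : ∀ {m n p} (S : CospanMat.SpanHom m n) (T : CospanMat.SpanHom n p) →
                  cospanRel (CospanMat.compose S T) ≈ˢ cospanRel S ⨾ˢ cospanRel T
    cospanRel-⨾ {m} {n} {p} S T = mk≈ˢ λ x y → mk⇔
      (λ { (lift eq) → middle x y (≋-trans (≋-sym (·-⟦⨾⟧ S.left P.p₁ x))
                                    (≋-trans eq (·-⟦⨾⟧ T.right P.p₂ y))) })
      (λ { (u , lift eq , lift eq′) → lift (≋-trans (·-⟦⨾⟧ S.left P.p₁ x)
             (≋-trans (·-congˡ ⟦ P.p₁ ⟧ᴹ eq) (≋-trans (≋-sym (·-⟦⨾⟧ S.right P.p₁ u))
             (≋-trans (·-congʳ (_⇒_.cong scalars P.commutes)) (≋-trans (·-⟦⨾⟧ T.left P.p₂ u)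
             (≋-trans (·-congˡ ⟦ P.p₂ ⟧ᴹ eq′) (≋-sym (·-⟦⨾⟧ T.right P.p₂ y)))))))) })
      where
      module S = CospanMat.SpanHom S
      module T = CospanMat.SpanHom T
      module P = Pullback (HasPullbacks.pullback hasPushouts S.right T.left)

      neg : ∀ {a} → Mk.V a → Mk.V a
      neg x i = (k.- k.1#) k.* x i

      a+-1*b≈0 : ∀ {a b} → a k.+ (k.- k.1#) k.* b k.≈ k.0# → a k.≈ b
      a+-1*b≈0 {a} {b} eq = RingProperties.x∙y⁻¹≈ε⇒x≈y k.ring a b
        (k.trans (k.+-congˡ (k.sym (RingProperties.-1*x≈-x k.ring b))) eq)

      a≈b⇒ : ∀ {a b} → a k.≈ b → a k.+ (k.- k.1#) k.* b k.≈ k.0#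
      a≈b⇒ {a} {b} eq = k.trans (k.+-congˡ (RingProperties.-1*x≈-x k.ring b))
                          (RingProperties.x≈y⇒x∙y⁻¹≈ε k.ring eq)

      W : Pred (Mk.V (S.apex + T.apex)) (c ⊔ ℓ)
      W v = ∃ λ u → v ≋ (⟦ S.right ⟧ᴹ · u) ++ neg (⟦ T.left ⟧ᴹ · u)

      isSub : IsSubmodule W
      isSub = record
        { resp = λ { eq (u , p) → u , ≋-trans (≋-sym eq) p }
        ; has-0 = 𝟎 , split-ext {S.apex}
            (≋-sym (≋-trans (take-++ (⟦ S.right ⟧ᴹ · 𝟎) _) (λ i → ⊙-𝟎ʳ (⟦ S.right ⟧ᴹ i))))
            (≋-sym (≋-trans (drop-++ (⟦ S.right ⟧ᴹ · 𝟎) _)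
              (λ i → k.trans (k.*-congˡ (⊙-𝟎ʳ (⟦ T.left ⟧ᴹ i))) (k.zeroʳ _))))
        ; add = λ { {x} {y} (u , p) (v , q) → _ , split-ext {S.apex}
            (λ i → k.trans (k.+-cong (tk p i) (tk q i)) (k.trans (k.sym (⊙-+ʳ (⟦ S.right ⟧ᴹ i) u v))
                     (k.sym (take-++ (⟦ S.right ⟧ᴹ · (λ j → u j k.+ v j)) _ i))))
            (λ i → k.trans (k.+-cong (dr p i) (dr q i)) (k.trans (k.sym (k.distribˡ _ _ _))
                     (k.trans (k.*-congˡ (k.sym (⊙-+ʳ (⟦ T.left ⟧ᴹ i) u v)))
                     (k.sym (drop-++ (⟦ S.right ⟧ᴹ · (λ j → u j k.+ v j)) _ i))))) }
        ; scale = λ { r {x} (u , p) → _ , split-ext {S.apex}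
            (λ i → k.trans (k.*-congˡ (tk p i)) (k.trans (k.sym (⊙-*ʳ r (⟦ S.right ⟧ᴹ i) u))
                     (k.sym (take-++ (⟦ S.right ⟧ᴹ · (λ j → r k.* u j)) _ i))))
            (λ i → k.trans (k.*-congˡ (dr p i)) (k.trans (k.sym (k.*-assoc _ _ _))
                     (k.trans (k.*-congʳ (k.*-comm _ _)) (k.trans (k.*-assoc _ _ _)
                     (k.trans (k.*-congˡ (k.sym (⊙-*ʳ r (⟦ T.left ⟧ᴹ i) u)))
                     (k.sym (drop-++ (⟦ S.right ⟧ᴹ · (λ j → r k.* u j)) _ i))))))) }
        }
        where
        tk : ∀ {x : Mk.V (S.apex + T.apex)} {u} → x ≋ (⟦ S.right ⟧ᴹ · u) ++ neg (⟦ T.left ⟧ᴹ · u) →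
             take S.apex x ≋ ⟦ S.right ⟧ᴹ · u
        tk p = ≋-trans (λ i → p (i ↑ˡ _)) (take-++ _ _)
        dr : ∀ {x : Mk.V (S.apex + T.apex)} {u} → x ≋ (⟦ S.right ⟧ᴹ · u) ++ neg (⟦ T.left ⟧ᴹ · u) →
             drop S.apex x ≋ neg (⟦ T.left ⟧ᴹ · u)
        dr {u = u} p = ≋-trans (λ i → p (S.apex ↑ʳ i)) (drop-++ (⟦ S.right ⟧ᴹ · u) _)

      -- a functional that vanishes on W factors through the pushout, so by
      -- separate the pair (A x , - D y) lies in W
      middle : ∀ x y → ⟦ P.p₁ ⟧ᴹ · (⟦ S.left ⟧ᴹ · x) ≋ ⟦ P.p₂ ⟧ᴹ · (⟦ T.right ⟧ᴹ · y) →
               rel (cospanRel S ⨾ˢ cospanRel T) x y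
      middle x y eq with separate W isSub ((⟦ S.left ⟧ᴹ · x) ++ neg (⟦ T.right ⟧ᴹ · y))
      ... | inj₁ (u , p) =
        let (p₁ , p₂) = ++-injective {x = ⟦ S.left ⟧ᴹ · x} p in
        u , lift p₁ , lift (λ i → k.sym (neg-injective (p₂ i)))
        where
        neg-injective : ∀ {a b} → (k.- k.1#) k.* a k.≈ (k.- k.1#) k.* b → a k.≈ b
        neg-injective {a} {b} q = RingProperties.-‿injective k.ring
          (k.trans (k.sym (RingProperties.-1*x≈-x k.ring a)) (k.trans q (RingProperties.-1*x≈-x k.ring b)))
      ... | inj₂ (φ , kills , φv≉0) = ⊥-elim (φv≉0 φv≈0)
        where
        Ax = ⟦ S.left ⟧ᴹ · x
        Dy = ⟦ T.right ⟧ᴹ · y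
        den = clear φ
        d   = proj₁ den
        φ′  = proj₁ (proj₂ den)
        d≉0 = ⟦d⟧≉0 (proj₁ (proj₂ (proj₂ den)))
        dφ  = proj₂ (proj₂ (proj₂ den))
        d⁻¹ = proj₁ (inverse d≉0)
        r   = take S.apex φ
        s   = drop S.apex φ
        r′  = take S.apex φ′
        s′  = drop S.apex φ′

        φ-++ : ∀ a b → φ ⊙ (a ++ neg b) k.≈ (r ⊙ a) k.+ (k.- k.1#) k.* (s ⊙ b)
        φ-++ a b = k.trans (⊙-cong (++-η S.apex φ) ≋-refl) (k.trans (⊙-++ r a s (neg b))
                     (k.+-congˡ (⊙-*ʳ (k.- k.1#) s b)))

        r≈s : ∀ u → r ⊙ (⟦ S.right ⟧ᴹ · u) k.≈ s ⊙ (⟦ T.left ⟧ᴹ · u)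
        r≈s u = a+-1*b≈0 (k.trans (k.sym (φ-++ _ _)) (kills _ (u , ≋-refl)))

        column : ∀ {a} (A : Matrix n a) (j : Fin n) → ⟦ (λ i → A i j) ⟧ᵛ ≋ ⟦ A ⟧ᴹ · I j
        column A j i = k.sym (k.trans (⊙-comm (⟦ A ⟧ᴹ i) (I j)) (I-⊙ j (⟦ A ⟧ᴹ i)))

        scaled : ∀ {a} (A : Matrix n a) (f : Mk.V a) (f′ : MR.V a) →
                 (λ i → ⟦ d ⟧ k.* f i) ≋ ⟦ f′ ⟧ᵛ → ∀ j →
                 ⟦ f′ MR.⊙ (λ i → A i j) ⟧ k.≈ ⟦ d ⟧ k.* (f ⊙ (⟦ A ⟧ᴹ · I j))
        scaled A f f′ df j = k.trans (⟦⟧-⊙ f′ _) (k.trans (⊙-cong (≋-sym df) (column A j))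
                               (⊙-*ˡ ⟦ d ⟧ f _))

        K : Matrix S.apex 1
        K _ = r′
        L : Matrix T.apex 1
        L _ = s′

        KL : S.right MR.⨾ᴹ K MR.≈ᴹ T.left MR.⨾ᴹ L
        KL i j = injective (k.trans (scaled S.right r r′ (λ i → dφ (i ↑ˡ _)) j)
          (k.trans (k.*-congˡ (r≈s (I j))) (k.sym (scaled T.left s s′ (λ i → dφ (S.apex ↑ʳ i)) j))))

        U : Matrix P.apex 1
        U = P.mediate K L KL

        through : ∀ {a} (A : Matrix a P.apex) (F : Matrix a 1) (x : Mk.V a) → A MR.⨾ᴹ U MR.≈ᴹ F →
                  ⟦ F ⟧ᴹ · x ≋ ⟦ U ⟧ᴹ · (⟦ A ⟧ᴹ · x)
        through A F x p = ≋-trans (·-congʳ (_⇒_.cong scalars (MatP.sym p))) (·-⟦⨾⟧ A U x)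

        KL-eq : ⟦ r′ ⟧ᵛ ⊙ Ax k.≈ ⟦ s′ ⟧ᵛ ⊙ Dy
        KL-eq = k.trans (through P.p₁ K Ax (P.mediate₁ KL) zero)
          (k.trans (·-congˡ ⟦ U ⟧ᴹ eq zero) (k.sym (through P.p₂ L Dy (P.mediate₂ KL) zero)))

        undo : ∀ {a} (f : Mk.V a) (f′ : MR.V a) (b : Mk.V a) → (λ i → ⟦ d ⟧ k.* f i) ≋ ⟦ f′ ⟧ᵛ →
               d⁻¹ k.* (⟦ f′ ⟧ᵛ ⊙ b) k.≈ f ⊙ b
        undo f f′ b df = k.trans (k.*-congˡ (k.trans (⊙-cong (≋-sym df) ≋-refl) (⊙-*ˡ ⟦ d ⟧ f b)))
          (k.trans (k.sym (k.*-assoc _ _ _)) (k.trans (k.*-congʳ (proj₂ (inverse d≉0))) (k.*-identityˡ _)))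

        φv≈0 : φ ⊙ (Ax ++ neg Dy) k.≈ k.0#
        φv≈0 = k.trans (φ-++ Ax Dy) (a≈b⇒ (k.trans (k.sym (undo r r′ Ax (λ i → dφ (i ↑ˡ _))))
          (k.trans (k.*-congˡ KL-eq) (undo s s′ Dy (λ i → dφ (S.apex ↑ʳ i))))))

  Φ : Span-Mat ⇒ SV
  Φ = record
    { map = spanRel
    ; cong = λ i → mk≈ˢ λ x y → mk⇔ (spanRel-⊆ i) (spanRel-⊆ (PROP.sym Span-Mat i))
    ; map-id = mk≈ˢ λ x y → mk⇔
        (λ { (z , p , q) → lift (≋-trans (≋-sym p) q) })
        (λ { (lift p) → x , ·-⟦I⟧ x , ≋-trans (·-⟦I⟧ x) p })
    ; map-⨾ = λ {f = S} {T} → spanRel-⨾ S T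
    ; map-⊕ = λ {m} {n} {p} {q} {S} {T} →
        let module S = SpanMat.SpanHom S
            module T = SpanMat.SpanHom T
        in mk≈ˢ λ x y → mk⇔
          (λ { (z , p , q) →
             let (p₁ , p₂) = ++-injective {x = ⟦ S.left ⟧ᴹ · take S.apex z} (≋-trans (≋-sym (·-⟦⊕⟧ S.left T.left z)) (≋-trans p (++-η m x)))
                 (q₁ , q₂) = ++-injective {x = ⟦ S.right ⟧ᴹ · take S.apex z} (≋-trans (≋-sym (·-⟦⊕⟧ S.right T.right z)) (≋-trans q (++-η n y)))
             in (take S.apex z , p₁ , q₁) , (drop S.apex z , p₂ , q₂) })
          (λ { ((z , p , q) , (z′ , p′ , q′)) → z ++ z′ ,
             ≋-trans (·-⟦⊕⟧ S.left T.left (z ++ z′)) (≋-trans (++-cong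
               (≋-trans (·-congˡ ⟦ S.left ⟧ᴹ (take-++ z z′)) p)
               (≋-trans (·-congˡ ⟦ T.left ⟧ᴹ (drop-++ z z′)) p′)) (≋-sym (++-η m x))) ,
             ≋-trans (·-⟦⊕⟧ S.right T.right (z ++ z′)) (≋-trans (++-cong
               (≋-trans (·-congˡ ⟦ S.right ⟧ᴹ (take-++ z z′)) q)
               (≋-trans (·-congˡ ⟦ T.right ⟧ᴹ (drop-++ z z′)) q′)) (≋-sym (++-η n y))) })
    ; map-σ = λ {m} {n} → mk≈ˢ λ x y → mk⇔
        (λ { (z , p , q) →
           let z≋x = ≋-trans (≋-sym (·-⟦I⟧ z)) p
               (q₁ , q₂) = ++-injective {x = drop m z} (≋-trans (≋-sym (·-⟦σ⟧ m n z)) (≋-trans q (++-η n y)))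
           in lift (≋-trans (λ i → k.sym (z≋x (i ↑ˡ n))) q₂ , ≋-trans (λ i → k.sym (z≋x (m ↑ʳ i))) q₁) })
        (λ { (lift (p , q)) → x , ·-⟦I⟧ x ,
           ≋-trans (·-⟦σ⟧ m n x) (≋-trans (++-cong q p) (≋-sym (++-η n y))) })
    }

  Ψ : Cospan-Mat ⇒ SV
  Ψ = record
    { map = cospanRel
    ; cong = λ i → mk≈ˢ λ x y → mk⇔ (cospanRel-⊆ (PROP.sym Cospan-Mat i)) (cospanRel-⊆ i)
    ; map-id = mk≈ˢ λ x y → mk⇔
        (λ { (lift p) → lift (≋-trans (≋-sym (·-⟦I⟧ x)) (≋-trans p (·-⟦I⟧ y))) })
        (λ { (lift p) → lift (≋-trans (·-⟦I⟧ x) (≋-trans p (≋-sym (·-⟦I⟧ y)))) })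
    ; map-⨾ = λ {f = S} {T} → cospanRel-⨾ S T
    ; map-⊕ = λ {m} {n} {p} {q} {S} {T} →
        let module S = CospanMat.SpanHom S
            module T = CospanMat.SpanHom T
        in mk≈ˢ λ x y → mk⇔
          (λ { (lift e) →
             let (e₁ , e₂) = ++-injective {x = ⟦ S.left ⟧ᴹ · take m x}
                   (≋-trans (≋-sym (·-⟦⊕⟧ S.left T.left x)) (≋-trans e (·-⟦⊕⟧ S.right T.right y)))
             in lift e₁ , lift e₂ })
          (λ { (lift e₁ , lift e₂) → lift (≋-trans (·-⟦⊕⟧ S.left T.left x)
             (≋-trans (++-cong e₁ e₂) (≋-sym (·-⟦⊕⟧ S.right T.right y)))) })
    ; map-σ = λ {m} {n} → mk≈ˢ λ x y → mk⇔
        (λ { (lift e) →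
           let e′ = ≋-trans (≋-sym (·-⟦I⟧ x)) (≋-trans e (·-⟦σ⟧ n m y))
           in lift (≋-trans (λ i → e′ (i ↑ˡ n)) (take-++ (drop n y) (take n y)) ,
                    ≋-trans (λ i → e′ (m ↑ʳ i)) (drop-++ (drop n y) (take n y))) })
        (λ { (lift (p , q)) → lift (≋-trans (·-⟦I⟧ x) (≋-trans (++-η m x)
           (≋-trans (++-cong p q) (≋-sym (·-⟦σ⟧ n m y))))) })
    }

  κ₁ : Mat ⇒ Span-Mat
  κ₁ = SpanMat.graphᴾ

  κ₂ : Mat ᵒᵖ ⇒ Span-Mat
  κ₂ = SpanMat.cographᴾ

  -- For cospans, as spans in Mat ᵒᵖ, graph and cograph exchange roles.
  ι₁ : Mat ⇒ Cospan-Mat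
  ι₁ = CospanMat.cographᴾ ∘ double-op Mat

  ι₂ : Mat ᵒᵖ ⇒ Cospan-Mat
  ι₂ = CospanMat.graphᴾ

{-# OPTIONS --safe #-}
module Submission where

-- Every subspace S is the image under Φ of a canonical span, given by a basis of
-- the R-module of its integral points.  A span P with Φ P = S factors through that
-- basis by a matrix W which is epic in Mat R, because its image over k is everything.
-- For epic W the cospan ι₂ W ⨾ ι₁ W is the identity, so a compatible pair (F , G)
-- sends κ₂ W ⨾ κ₁ W to the identity, and F P depends on S only.  As a cospan is
-- ι₁ A ⨾ ι₂ B, the values of G are determined by those of F.

open import Level using (Level; _⊔_; lift)
open import Algebra.Bundles using (CommutativeRing)
open import Algebra.Morphism.Structures using (IsRingMonomorphism)
open import Data.Fin.Base using (Fin; _↑ˡ_; _↑ʳ_)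
open import Data.Nat.Base using (_+_)
open import Data.Product.Base using (∃; ∃₂; _×_; _,_; proj₁; proj₂)
open import Data.Vec.Functional using (_++_; take; drop)
open import Function.Bundles using (mk⇔; Equivalence)
open import Relation.Unary using (Pred)
import Relation.Binary.Reasoning.Setoid as SetoidReasoning
open import Defs

open _⇒_ using (map)

private
  variable
    c ℓ h e h₁ e₁ : Level

-- Spans in a PROP with pullbacks.

module SpanProperties (C : PROP h e) (pullbacks : HasPullbacks C) where
  open PROP C
  open PROPProperties C
  open Spans C pullbacks

  IsEpi : ∀ {m n} → Hom m n → Set (h ⊔ e)
  IsEpi {n = n} w = ∀ {p} {f g : Hom n p} → w ⨾ f ≈ w ⨾ g → f ≈ g

  -- The legs meet in an identity. Applied to `Mat ᵒᵖ`, this decomposes a cospan as `ι₁ A` followed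
  -- by `ι₂ B`.
  cograph-graph : ∀ {z m n} {f : Hom z m} {g : Hom z n} →
                  span f g ≅ compose (cograph f) (graph g)
  cograph-graph = ≅-trans (≈⇒≅ (sym idˡ) refl) compose-cograph

  -- The kernel pair of a mono consists of identities. In `Mat ᵒᵖ` the hypothesis says that `w` is
  -- epic in `Mat`, and the composite is `ι₂ w` followed by `ι₁ w`.
  mono-kernelPair : ∀ {m n} {w : Hom m n} →
                    (∀ {p} {f g : Hom p m} → f ⨾ w ≈ g ⨾ w → f ≈ g) →
                    compose (graph w) (cograph w) ≅ graph id
  mono-kernelPair {w = w} mono = ≅-sym (≅-trans (≈⇒≅ (sym idˡ) (sym idˡ))
    (compose-char (graph w) (cograph w) record
      { commutes = refl
      ; mediate  = λ k l eq → k
      ; mediate₁ = λ eq → idʳ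
      ; mediate₂ = λ eq → trans idʳ (mono eq)
      ; unique   = λ eq _ → trans (sym idʳ) (trans eq idʳ)
      }))

  module _ {X : PROP h₁ e₁} (F : Span ⇒ X) where
    private
      module X = PROP X
      module F = _⇒_ F

    -- The span on the left is `cograph f`, then `cograph w` and `graph w`, then `graph g`; `F`
    -- collapses the middle pair.
    cancel-apex : ∀ {y z m n} {w : Hom y z} {f : Hom z m} {g : Hom z n} →
                  map F (compose (cograph w) (graph w)) X.≈ X.id →
                  map F (span (w ⨾ f) (w ⨾ g)) X.≈ map F (span f g)
    cancel-apex {w = w} {f} {g} eq = begin
      map F (span (w ⨾ f) (w ⨾ g))
        ≈⟨ F.cong (≅-trans compose-cograph (compose-cong ≅-refl
             (≅-trans compose-graph (compose-cong cograph-graph ≅-refl)))) ⟩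
      map F (compose (cograph f) (compose (compose (cograph w) (graph w)) (graph g)))
        ≈⟨ X.trans F.map-⨾ (X.⨾-cong X.refl F.map-⨾) ⟩
      map F (cograph f) X.⨾ map F (compose (cograph w) (graph w)) X.⨾ map F (graph g)
        ≈⟨ X.⨾-cong X.refl (X.trans (X.⨾-cong eq X.refl) X.idˡ) ⟩
      map F (cograph f) X.⨾ map F (graph g)
        ≈⟨ X.trans (F.cong cograph-graph) F.map-⨾ ⟨
      map F (span f g) ∎
      where open SetoidReasoning (X.setoid _ _)

module SquareProperties
  {R : CommutativeRing c ℓ} {k : CommutativeRing (c ⊔ ℓ) ℓ}
  (⟦_⟧ : CommutativeRing.Carrier R → CommutativeRing.Carrier k)
  (isPID : IsPID R) (isFrac : IsFieldOfFractions R k ⟦_⟧) where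

  open Square ⟦_⟧ isPID isFrac
  open PID isPID
  open IsFieldOfFractions isFrac
  open IsField isField
  open IsRingMonomorphism isMonomorphism
  open Subspaces k
  private
    module R = CommutativeRing R
    module k = CommutativeRing k
    module MR = Matrices R
    module Mk = Matrices k
    module MatP = PROP MR.Mat
    module SV = PROP SV
    module Span = PROP Span-Mat
    module SpanP = SpanProperties MR.Mat hasPullbacks
    module CospanP = SpanProperties (MR.Mat ᵒᵖ) hasPushouts
  open Mk using (_≋_; ≋-sym; ≋-trans; _·_)
  open MR using (Matrix)
  open SpanP using (IsEpi)
  open SpanMat using (span; graph; cograph)

  -- Commutativity of the square.

  Φκ₁≗Ψι₁ : Φ ∘ κ₁ ≗ Ψ ∘ ι₁
  Φκ₁≗Ψι₁ A = mk≈ˢ λ x y → mk⇔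
    (λ { (z , p , q) → lift (≋-trans
           (Mk.·-congˡ ⟦ A ⟧ᴹ (≋-trans (≋-sym p) (·-⟦I⟧ z)))
           (≋-trans q (≋-sym (·-⟦I⟧ y)))) })
    (λ { (lift p) → x , ·-⟦I⟧ x , ≋-trans p (·-⟦I⟧ y) })

  Φκ₂≗Ψι₂ : Φ ∘ κ₂ ≗ Ψ ∘ ι₂
  Φκ₂≗Ψι₂ A = mk≈ˢ λ x y → mk⇔
    (λ { (z , p , q) → lift (≋-trans (·-⟦I⟧ x) (≋-trans (≋-sym p)
           (Mk.·-congˡ ⟦ A ⟧ᴹ (≋-trans (≋-sym (·-⟦I⟧ z)) q)))) })
    (λ { (lift p) → y , ≋-trans (≋-sym p) (·-⟦I⟧ x) , ·-⟦I⟧ y })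

  -- Both sides are morphisms out of the coproduct that extend the pair `Ψ ∘ ι₁`, `Ψ ∘ ι₂`.
  square-commutes : Φ ∘ [ κ₁ , κ₂ ] ≗ Ψ ∘ [ ι₁ , ι₂ ]
  square-commutes f = SV.trans
    (Coproduct.[]-unique (Ψ ∘ ι₁) (Ψ ∘ ι₂) (Φ ∘ [ κ₁ , κ₂ ]) Φκ₁≗Ψι₁ Φκ₂≗Ψι₂ f)
    (SV.sym (Coproduct.[]-unique (Ψ ∘ ι₁) (Ψ ∘ ι₂) (Ψ ∘ [ ι₁ , ι₂ ])
      (λ _ → SV.refl) (λ _ → SV.refl) f))

  -- Reduces the values of `Ψ` to values of `Φ`, at the span that is the pullback of the cospan.
  Ψ-cospan : ∀ {m n z} (A : Matrix m z) (B : Matrix n z) →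
             map Ψ (CospanMat.span A B) ≈ˢ map Φ (graph A Span.⨾ cograph B)
  Ψ-cospan A B = begin
    map Ψ (CospanMat.span A B)
      ≈⟨ _⇒_.cong Ψ (CospanP.cograph-graph {f = A} {B}) ⟩
    map Ψ (CospanMat.compose (map ι₁ A) (map ι₂ B))
      ≈⟨ _⇒_.map-⨾ Ψ {f = map ι₁ A} {map ι₂ B} ⟩
    map Ψ (map ι₁ A) SV.⨾ map Ψ (map ι₂ B)
      ≈⟨ SV.⨾-cong (Φκ₁≗Ψι₁ A) (Φκ₂≗Ψι₂ B) ⟨
    map Φ (graph A) SV.⨾ map Φ (cograph B)
      ≈⟨ _⇒_.map-⨾ Φ {f = graph A} {cograph B} ⟨
    map Φ (graph A Span.⨾ cograph B) ∎
    where open SetoidReasoning (SV.setoid _ _)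

  -- Denominators, and epis over R.

  infixr 7 _*ᴷ_ _*ᴿ_
  _*ᴷ_ : ∀ {n} → k.Carrier → Mk.V n → Mk.V n
  (a *ᴷ x) i = a k.* x i

  _*ᴿ_ : ∀ {n} → R.Carrier → MR.V n → MR.V n
  (a *ᴿ x) i = a R.* x i

  module _ {d : R.Carrier} (d≉0 : d R.≉ R.0#) where

    d⁻¹ : k.Carrier
    d⁻¹ = proj₁ (inverse (⟦d⟧≉0 d≉0))

    d⁻¹*d* : ∀ a → d⁻¹ k.* (⟦ d ⟧ k.* a) k.≈ a
    d⁻¹*d* a = k.trans (k.sym (k.*-assoc _ _ _))
      (k.trans (k.*-congʳ (proj₂ (inverse (⟦d⟧≉0 d≉0)))) (k.*-identityˡ a))

  ·-clear : ∀ {m n} {d} (A : Matrix m n) {x : Mk.V m} {x′ : MR.V m} →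
            ⟦ d ⟧ *ᴷ x ≋ ⟦ x′ ⟧ᵛ → ⟦ d ⟧ *ᴷ (⟦ A ⟧ᴹ · x) ≋ ⟦ A MR.· x′ ⟧ᵛ
  ·-clear {d = d} A {x} {x′} eq i = k.trans (k.sym (Mk.⊙-*ʳ ⟦ d ⟧ (⟦ A ⟧ᴹ i) x))
    (k.trans (Mk.·-congˡ ⟦ A ⟧ᴹ eq i) (k.sym (⟦⟧-· A x′ i)))

  ⟦⟧ᵛ-column : ∀ {m n} (A : Matrix m n) (j : Fin m) → ⟦ A ⟧ᴹ · Mk.I j ≋ ⟦ (λ i → A i j) ⟧ᵛ
  ⟦⟧ᵛ-column A j i = k.trans (Mk.⊙-comm (⟦ A ⟧ᴹ i) (Mk.I j)) (Mk.I-⊙ j (⟦ A ⟧ᴹ i))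

  -- Two matrices that agree on the image of `W` agree on a nonzero multiple of each `u`, and the
  -- multiplier cancels in a domain. So `W` may be epic without being surjective over R.
  cofinal⇒epi : ∀ {m n} {W : Matrix m n} →
                (∀ u → ∃₂ λ d z → d R.≉ R.0# × W MR.· z MR.≋ d *ᴿ u) → IsEpi W
  cofinal⇒epi {W = W} cofinal {f = A} {B} eq = MR.·-ext λ u i →
    let (d , z , d≉0 , Wz) = cofinal u
        along : ∀ {p} (C : Matrix _ p) → (W MR.⨾ᴹ C) MR.· z MR.≋ d *ᴿ (C MR.· u)
        along C = MR.≋-trans (MR.·-⨾ W C z) (MR.≋-trans (MR.·-congˡ C Wz)
                    (λ i → MR.⊙-*ʳ d (C i) u))
    in *-cancelʳ d≉0 (R.trans (R.*-comm _ d) (R.trans (R.sym (along A i))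
         (R.trans (MR.·-congʳ eq i) (R.trans (along B i) (R.*-comm d _)))))

  -- The canonical span of a subspace.

  module _ {m n} (S : Subspace m n) where
    private module S = Subspace S

    Integral : Pred (MR.V (m + n)) (c ⊔ ℓ)
    Integral v = rel S ⟦ take m v ⟧ᵛ ⟦ drop m v ⟧ᵛ

    integral-submodule : MR.IsSubmodule Integral
    integral-submodule = record
      { resp  = λ eq → S.resp (λ i → ⟦⟧-cong (eq (i ↑ˡ n))) (λ i → ⟦⟧-cong (eq (m ↑ʳ i)))
      ; has-0 = S.resp (λ _ → k.sym 0#-homo) (λ _ → k.sym 0#-homo) S.has-0
      ; add   = λ p q → S.resp (λ _ → k.sym (+-homo _ _)) (λ _ → k.sym (+-homo _ _)) (S.add p q)
      ; scale = λ r p → S.resp (λ _ → k.sym (*-homo _ _)) (λ _ → k.sym (*-homo _ _)) (S.scale ⟦ r ⟧ p)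
      }

    open Basis (basis Integral integral-submodule)

    leg₁ : Matrix rank m
    leg₁ = take m matrix

    leg₂ : Matrix rank n
    leg₂ = drop m matrix

    integralSpan : SpanMat.SpanHom m n
    integralSpan = span leg₁ leg₂

    -- Up to a nonzero scalar every vector over k is integral. One inclusion clears the denominators
    -- of the apex vector, the other those of the point of `S`; both divide by `d` at the end.
    spanRel-integralSpan : spanRel integralSpan ≈ˢ S
    spanRel-integralSpan = mk≈ˢ λ x y → mk⇔
      (λ { (z , p , q) →
        let (d , z′ , d≉0 , eq) = clear z
            restore : ∀ {p} (A : Matrix rank p) {x} → ⟦ A ⟧ᴹ · z ≋ x →
                      d⁻¹ d≉0 *ᴷ ⟦ A MR.· z′ ⟧ᵛ ≋ x
            restore A r i = k.trans (k.*-congˡ (k.sym (·-clear A eq i)))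
                              (k.trans (d⁻¹*d* d≉0 _) (r i))
        in S.resp (restore leg₁ p) (restore leg₂ q) (S.scale (d⁻¹ d≉0) (member z′)) })
      (λ s →
        let (d , v , d≉0 , eq) = clear (x ++ y)
            eq₁ : ⟦ d ⟧ *ᴷ x ≋ ⟦ take m v ⟧ᵛ
            eq₁ i = k.trans (k.*-congˡ (k.sym (Mk.take-++ x y i))) (eq (i ↑ˡ n))
            eq₂ : ⟦ d ⟧ *ᴷ y ≋ ⟦ drop m v ⟧ᵛ
            eq₂ i = k.trans (k.*-congˡ (k.sym (Mk.drop-++ x y i))) (eq (m ↑ʳ i))
            (u , Bu) = spanning {v} (S.resp eq₁ eq₂ (S.scale ⟦ d ⟧ s))
            divide : ∀ {p} (A : Matrix rank p) {x} {w : MR.V p} → A MR.· u MR.≋ w →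
                     ⟦ d ⟧ *ᴷ x ≋ ⟦ w ⟧ᵛ → ⟦ A ⟧ᴹ · (d⁻¹ d≉0 *ᴷ ⟦ u ⟧ᵛ) ≋ x
            divide A {x} Au dx i = k.trans (Mk.⊙-*ʳ _ (⟦ A ⟧ᴹ i) ⟦ u ⟧ᵛ) (k.trans
              (k.*-congˡ (k.trans (k.sym (⟦⟧-· A u i)) (k.trans (⟦⟧-cong (Au i)) (k.sym (dx i)))))
              (d⁻¹*d* d≉0 (x i)))
        in d⁻¹ d≉0 *ᴷ ⟦ u ⟧ᵛ ,
           divide leg₁ (λ i → Bu (i ↑ˡ n)) eq₁ , divide leg₂ (λ i → Bu (m ↑ʳ i)) eq₂)

    module _ {z} {A : Matrix z m} {B : Matrix z n} (AB≈S : spanRel (span A B) ≈ˢ S) where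

      private
        -- The j-th columns of `A` and `B` form an integral point of `S`, the image of the j-th unit
        -- vector. Its coordinates in the basis become column j of `factor`.
        column : ∀ j → ∃ λ u → matrix MR.· u MR.≋ (λ i → A i j) ++ (λ i → B i j)
        column j = spanning (S.resp
          (λ i → ⟦⟧-cong (R.sym (MR.take-++ (λ i → A i j) (λ i → B i j) i)))
          (λ i → ⟦⟧-cong (R.sym (MR.drop-++ (λ i → A i j) (λ i → B i j) i)))
          (Equivalence.to (equivalent AB≈S _ _)
            (Mk.I j , ⟦⟧ᵛ-column A j , ⟦⟧ᵛ-column B j)))

      factor : Matrix z rank
      factor i j = proj₁ (column j) i

      factor₁ : factor MR.⨾ᴹ leg₁ MR.≈ᴹ A
      factor₁ i j = R.trans (proj₂ (column j) (i ↑ˡ n)) (MR.take-++ (λ i → A i j) (λ i → B i j) i)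

      factor₂ : factor MR.⨾ᴹ leg₂ MR.≈ᴹ B
      factor₂ i j = R.trans (proj₂ (column j) (m ↑ʳ i)) (MR.drop-++ (λ i → A i j) (λ i → B i j) i)

      -- The point of `S` with coordinates `u` comes from some `x` over k. If `d` clears `x` to
      -- `x′`, then `factor` sends `x′` to `d *ᴿ u`, since basis coordinates are unique.
      factor-epi : IsEpi factor
      factor-epi = cofinal⇒epi {W = factor} λ u →
        let (x , p , q) = Equivalence.from (equivalent AB≈S _ _) (member u)
            (d , x′ , d≉0 , eq) = clear x
            -- Compares the two coordinate vectors after a leg `L`, where `factor` followed by `L`
            -- is the known matrix `C`.
            along : ∀ {p} (C : Matrix z p) (L : Matrix rank p) → factor MR.⨾ᴹ L MR.≈ᴹ C →
                    ⟦ C ⟧ᴹ · x ≋ ⟦ L MR.· u ⟧ᵛ →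
                    L MR.· (factor MR.· x′) MR.≋ L MR.· (d *ᴿ u)
            along C L W⨾L≈C Cx i =
              R.trans (R.sym (MR.·-⨾ factor L x′ i)) (R.trans (MR.·-congʳ W⨾L≈C i)
                (R.trans (injective (k.trans (k.sym (·-clear C eq i))
                  (k.trans (k.*-congˡ (Cx i)) (k.sym (*-homo d _)))))
                (R.sym (MR.⊙-*ʳ d (L i) u))))
        in d , x′ , d≉0 , independent
             (MR.split-ext {m} (along A leg₁ factor₁ p) (along B leg₂ factor₂ q))

  -- The mediating morphism.

  module _ {a b} {X : PROP a b} (F : Span-Mat ⇒ X) (G : Cospan-Mat ⇒ X)
           (eq₁ : F ∘ κ₁ ≗ G ∘ ι₁) (eq₂ : F ∘ κ₂ ≗ G ∘ ι₂) where
    private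
      module X = PROP X
      module F = _⇒_ F
      module G = _⇒_ G

    -- Among spans this composite is the identity only for invertible `W`. Compatibility moves it to
    -- cospans, where it is the cokernel pair of an epi.
    F-epi : ∀ {m n} {W : Matrix m n} → IsEpi W →
            map F (SpanMat.compose (cograph W) (graph W)) X.≈ X.id
    F-epi {W = W} epi = begin
      map F (SpanMat.compose (cograph W) (graph W))     ≈⟨ F.map-⨾ ⟩
      map F (cograph W) X.⨾ map F (graph W)             ≈⟨ X.⨾-cong (eq₂ W) (eq₁ W) ⟩
      map G (map ι₂ W) X.⨾ map G (map ι₁ W)             ≈⟨ G.map-⨾ ⟨
      map G (CospanMat.compose (map ι₂ W) (map ι₁ W))   ≈⟨ G.cong (CospanP.mono-kernelPair epi) ⟩
      map G (CospanMat.graph MR.I)                      ≈⟨ G.map-id ⟩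
      X.id                                              ∎
      where open SetoidReasoning (X.setoid _ _)

    F-integralSpan : ∀ {m n} (P : SpanMat.SpanHom m n) {S : Subspace m n} → spanRel P ≈ˢ S →
                     map F P X.≈ map F (integralSpan S)
    F-integralSpan P {S} P≈S = X.trans
      (F.cong (SpanMat.≈⇒≅ (MatP.sym (factor₁ S P≈S)) (MatP.sym (factor₂ S P≈S))))
      (SpanP.cancel-apex F (F-epi (factor-epi S P≈S)))

    F-respects-Φ : ∀ {m n} (P Q : SpanMat.SpanHom m n) → map Φ P ≈ˢ map Φ Q → map F P X.≈ map F Q
    F-respects-Φ P Q eq = X.trans (F-integralSpan P eq) (X.sym (F-integralSpan Q SV.refl))

    H : SV ⇒ X
    H = record
      { map    = λ S → map F (integralSpan S)
      ; cong   = λ {_} {_} {S} {T} eq → F-respects-Φ (integralSpan S) (integralSpan T)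
          (SV.trans (spanRel-integralSpan S)
          (SV.trans eq (SV.sym (spanRel-integralSpan T))))
      ; map-id = X.trans (reflect Span.id (_⇒_.map-id Φ)) F.map-id
      ; map-⨾  = λ {f = S} {T} → X.trans
          (reflect (integralSpan S Span.⨾ integralSpan T) (SV.trans (_⇒_.map-⨾ Φ {f = integralSpan S} {integralSpan T})
            (SV.⨾-cong (spanRel-integralSpan S) (spanRel-integralSpan T))))
          F.map-⨾
      ; map-⊕  = λ {f = S} {T} → X.trans
          (reflect (integralSpan S Span.⊕ integralSpan T) (SV.trans (_⇒_.map-⊕ Φ {f = integralSpan S} {integralSpan T})
            (SV.⊕-cong (spanRel-integralSpan S) (spanRel-integralSpan T))))
          F.map-⊕
      ; map-σ  = λ {m} {n} → X.trans (reflect (Span.σ m n) (_⇒_.map-σ Φ)) F.map-σ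
      }
      where
      -- Any span representing `S` computes the value at `S`, so each law of `Φ` becomes the same
      -- law for `H`.
      reflect : ∀ {m n} {S : Subspace m n} (P : SpanMat.SpanHom m n) → map Φ P ≈ˢ S →
                map F (integralSpan S) X.≈ map F P
      reflect P eq = X.sym (F-integralSpan P eq)

    HΦ≗F : H ∘ Φ ≗ F
    HΦ≗F P = X.sym (F-integralSpan P SV.refl)

    HΨ≗G : H ∘ Ψ ≗ G
    HΨ≗G T@(CospanMat.span A B) = begin
      map H (map Ψ T)                        ≈⟨ _⇒_.cong H {f = map Ψ T} {map Φ P} (Ψ-cospan A B) ⟩
      map H (map Φ P)                        ≈⟨ HΦ≗F P ⟩
      map F P                                ≈⟨ F.map-⨾ ⟩
      map F (graph A) X.⨾ map F (cograph B)  ≈⟨ X.⨾-cong (eq₁ A) (eq₂ B) ⟩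
      map G (map ι₁ A) X.⨾ map G (map ι₂ B)  ≈⟨ X.trans (G.cong (CospanP.cograph-graph {f = A} {B})) G.map-⨾ ⟨
      map G T                                ∎
      where
      open SetoidReasoning (X.setoid _ _)
      -- The pullback of the cospan `T`, written as a composite on which `F` and `G` can be
      -- compared.
      P = graph A Span.⨾ cograph B

    -- `Φ` is full: each `S` is the image of `integralSpan S`.
    H-unique : (K : SV ⇒ X) → K ∘ Φ ≗ F → K ≗ H
    H-unique K KΦ≗F S = X.trans (_⇒_.cong K (SV.sym (spanRel-integralSpan S))) (KΦ≗F (integralSpan S))

theorem6p15 : ∀ {c ℓ a b} (R : CommutativeRing c ℓ) (k : CommutativeRing (c ⊔ ℓ) ℓ)
    (⟦_⟧ : CommutativeRing.Carrier R → CommutativeRing.Carrier k)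
    (isPID : IsPID R) (isFrac : IsFieldOfFractions R k ⟦_⟧) →
    let open Square ⟦_⟧ isPID isFrac in
    IsPushout a b [ κ₁ , κ₂ ] [ ι₁ , ι₂ ] Φ Ψ
theorem6p15 R k ⟦_⟧ isPID isFrac = record
  { commutes  = square-commutes
  ; universal = λ X F G eq →
      let eq₁ : F ∘ κ₁ ≗ G ∘ ι₁
          -- On the injections the copairings compute to their components.
          eq₁ f = eq (Coproduct.inl f)
          eq₂ : F ∘ κ₂ ≗ G ∘ ι₂
          eq₂ f = eq (Coproduct.inr f)
      in H F G eq₁ eq₂ , HΦ≗F F G eq₁ eq₂ , HΨ≗G F G eq₁ eq₂ ,
         λ K KΦ≗F _ → H-unique F G eq₁ eq₂ K KΦ≗F
  }
  where
  open Square ⟦_⟧ isPID isFrac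
  open SquareProperties ⟦_⟧ isPID isFrac
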